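{- Let $p<q<r$ be odd primes such that $r=\alpha p+\beta q\le\varphi(pq)$ for some integers $\alpha,\beta>0$. Let $p'\in\{1,2,\ldots,q-1\}$ be the inverse of $p$ modulo $q$ and let $q'\in\{1,2,\ldots,p-1\}$ be the inverse of $q$ modulo $p$. Then $$C(pqr)=\max\left\{\min\left\{\left\lceil\frac{p'}{\alpha}\right\rceil,\left\lceil\frac{q'}{\beta}\right\rceil\right\},\ \min\left\{\left\lceil\frac{q-p'}{\alpha}\right\rceil,\left\lceil\frac{p-q'}{\beta}\right\rceil\right\}\right\}.$$
   Context: $\varphi$ is Euler's totient function. $\Phi_n(x)=\prod_{1\le k\le n,\ (k,n)=1}(x-e^{2k\pi i/n})$ is the $n$th cyclotomic polynomial, and the $n$th inverse cyclotomic polynomial is $\Psi_n(x)=\dfrac{x^n-1}{\Phi_n(x)}$. The height of a polynomial is the maximal absolute value of its coefficients; $C(n)$ denotes the height of $\Psi_n$. -}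

module Defs where

open import Algebra.Apartness.Bundles using (HeytingCommutativeRing; HeytingField)
open import Algebra.Bundles using (CommutativeRing)
open import Algebra.Bundles.Raw using (RawRing)
open import Data.Integer.Base as ℤ using (ℤ; +_; -[1+_]; ∣_∣)
open import Data.List.Base using (List; []; _∷_; _++_; map; foldr; filter; length; replicate; upTo)
open import Data.Nat.Base as ℕ using (ℕ; zero; suc; _<_)
open import Data.Nat.Coprimality using (coprime?)
open import Data.Nat.Divisibility using (_∣_; _∤_)
open import Data.Nat.Primality using (Prime)
open import Level using (_⊔_)
open import Data.Product.Base using (_×_; ∃-syntax)
open import Relation.Binary.PropositionalEquality.Core using (_≡_)

OddPrime : ℕ → Set
OddPrime p = Prime p × 2 ∤ p

totatives : ℕ → List ℕ
totatives n = filter (λ k → coprime? k n) (map suc (upTo n))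

φ : ℕ → ℕ
φ n = length (totatives n)

infix 4 _≡_[mod_]

_≡_[mod_] : ℕ → ℕ → ℕ → Set
a ≡ b [mod m ] = m ∣ ∣ + a ℤ.- + b ∣

record IsInverseMod (m a b : ℕ) : Set where
  field
    positive : 0 < b
    bounded  : b < m
    inverse  : a ℕ.* b ≡ 1 [mod m ]

-- Coefficient lists, constant term first; trailing zeros are allowed, so
-- equality of polynomials is _≋_ rather than equality of lists.
module Polynomial {c ℓ} (R : RawRing c ℓ) where
  open RawRing R

  Poly : Set c
  Poly = List Carrier

  coeff : Poly → ℕ → Carrier
  coeff []      _       = 0#
  coeff (a ∷ f) zero    = a
  coeff (a ∷ f) (suc i) = coeff f i

  infix  4 _≋_
  infixl 6 _⊕_
  infixl 7 _⊗_

  _≋_ : Poly → Poly → Set ℓ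
  f ≋ g = ∀ i → coeff f i ≈ coeff g i

  _⊕_ : Poly → Poly → Poly
  []      ⊕ g       = g
  (a ∷ f) ⊕ []      = a ∷ f
  (a ∷ f) ⊕ (b ∷ g) = a + b ∷ f ⊕ g

  _⊗_ : Poly → Poly → Poly
  []      ⊗ g = []
  (a ∷ f) ⊗ g = map (a *_) g ⊕ (0# ∷ f ⊗ g)

  const : Carrier → Poly
  const a = a ∷ []

  X^_ : ℕ → Poly
  X^ n = replicate n 0# ++ const 1#

  ∏ : List Poly → Poly
  ∏ = foldr _⊗_ (const 1#)

height : List ℤ → ℕ
height f = foldr ℕ._⊔_ 0 (map ∣_∣ f)

-- In the absence of complex numbers the field is a parameter: K stands for ℂ
-- and ζ for exp(2πi/n).  Results are stated for K of characteristic zero and ζ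
-- of exact multiplicative order n, with K = ℂ, ζ = exp(2πi/n) an instance.
module Cyclotomic {c ℓ₁ ℓ₂} (K : HeytingField c ℓ₁ ℓ₂) where
  open HeytingField K using (Carrier; _≈_; _#_; -_; 0#; 1#; heytingCommutativeRing)
  open HeytingCommutativeRing heytingCommutativeRing using (commutativeRing)
  open CommutativeRing commutativeRing using (rawRing; semiring)
  open import Algebra.Properties.Semiring.Exp semiring using (_^_)
  open import Algebra.Properties.Semiring.Mult semiring using () renaming (_×_ to _·_)
  open Polynomial rawRing

  CharacteristicZero : Set ℓ₂
  CharacteristicZero = ∀ n → (suc n · 1#) # 0#

  record IsPrimitiveRoot (n : ℕ) (ζ : Carrier) : Set (ℓ₁ ⊔ ℓ₂) where
    field
      root  : ζ ^ n ≈ 1#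
      exact : ∀ k → 0 < k → k < n → ζ ^ k # 1#

  Φ : ℕ → Carrier → Poly
  Φ n ζ = ∏ (map (λ k → X^ 1 ⊕ const (- (ζ ^ k))) (totatives n))

  fromℤ : ℤ → Carrier
  fromℤ (+ n)    = n · 1#
  fromℤ -[1+ n ] = - (suc n · 1#)

  -- Ψ = (xⁿ − 1) / Φₙ, which has integer coefficients.  As Φₙ is monic, this
  -- determines Ψ up to trailing zeros in characteristic zero.
  IsInverseCyclotomic : ℕ → Carrier → List ℤ → Set ℓ₁
  IsInverseCyclotomic n ζ Ψ = map fromℤ Ψ ⊗ Φ n ζ ≋ X^ n ⊕ const (- 1#)

  -- C(n) = h.  The existence of Ψ is included so that the statement about its
  -- height is not vacuous.
  InverseCyclotomicHeight : ℕ → Carrier → ℤ → Set ℓ₁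
  InverseCyclotomicHeight n ζ h =
    (∃[ Ψ ] IsInverseCyclotomic n ζ Ψ) ×
    (∀ Ψ → IsInverseCyclotomic n ζ Ψ → + height Ψ ≡ h)

{-# OPTIONS --safe #-}

-- Since Φ_pqr(x) = Φ_pq(xʳ) / Φ_pq(x), one has Ψ_pqr(x) = Φ_pq(x) Ψ_pq(xʳ) with
-- Ψ_pq(y) = (y^q − 1)(1 + y + ⋯ + y^(p−1)).  By Lam and Leung the coefficient of
-- x^m in Φ_pq is +1 when m = x p + y q with x < p′, y < q′, it is −1 when
-- m = 1 + x p + y q with x < q − p′, y < p − q′, and it is 0 otherwise.
-- A coefficient of Ψ_pqr is therefore a signed sum of coefficients of Φ_pq along
-- a progression of difference r = α p + β q.  One step along it moves (x , y) by
-- (α , β), and uniqueness of representations shows that the nonzero terms of a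
-- progression are consecutive and of the same sign.  Hence there are at most
-- min(⌈p′/α⌉, ⌈q′/β⌉) of them, or min(⌈(q−p′)/α⌉, ⌈(p−q′)/β⌉), and runs that
-- start at m = 0 and at m = 1 attain these bounds.
--
-- Over K, the product of all x − ζᵏ is fixed by x ↦ ζx, so it is xⁿ − 1; then Φ_pqr
-- is obtained by inclusion–exclusion over the divisors of pqr.
module Submission where

open import Defs
open import Algebra.Apartness.Bundles using (HeytingCommutativeRing; HeytingField)
import Algebra.Apartness.Properties.HeytingCommutativeRing as HeytingCommutativeRingProperties
open import Algebra.Bundles using (CommutativeMonoid; CommutativeRing)
import Algebra.Properties.AbelianGroup as AbelianGroupProperties
import Algebra.Properties.CommutativeSemigroup as CommutativeSemigroupProperties
import Algebra.Properties.Ring as RingProperties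
import Algebra.Properties.Semiring.Exp as Exp
import Algebra.Properties.Semiring.Mult as Mult
import Algebra.Solver.CommutativeMonoid as CommutativeMonoidSolver
open import Algebra.Structures using (IsCommutativeRing)
open import Data.Bool.Base using (Bool; true; false; if_then_else_; not; _∧_)
open import Data.Fin.Patterns using (0F; 1F; 2F; 3F; 4F; 5F)
open import Data.Integer.Base as ℤ using (ℤ; +_; -[1+_]; _⊖_; ∣_∣)
import Data.Integer.DivMod as ℤ
import Data.Integer.Properties as ℤ
import Data.Integer.Tactic.RingSolver as ℤ-Solver
open import Data.List.Base using (List; []; _∷_; map; filter; applyUpTo; upTo)
import Data.List.Properties as List
open import Data.Nat.Base as ℕ using (ℕ; zero; suc; NonZero; z≤n; s≤s; z<s; s<s)
open import Data.Nat.Coprimality as Coprimality using (Coprime; coprime?; coprime-divisor; prime⇒coprime)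
open import Data.Nat.Divisibility as ℕ using (_∣_; _∤_; _∣?_; divides)
open import Data.Nat.Primality using (Prime; prime⇒irreducible; prime⇒nonZero; ¬prime[1])
import Data.Nat.Properties as ℕ
import Data.Nat.Tactic.RingSolver as ℕ-Solver
open import Data.Product.Base using (∃₂; ∃-syntax; _×_; _,_; proj₁; proj₂)
open import Data.Rational.Unnormalised.Base using (_/_; ceiling)
open import Data.Sum.Base using (_⊎_; inj₁; inj₂)
open import Data.Vec.Base as Vec using ()
open import Function.Base using (_∘_)
open import Function.Bundles using (mk⇔)
import Level
import Relation.Binary.Reasoning.Setoid as SetoidReasoning
open import Relation.Binary.PropositionalEquality as ≡ using (_≡_; _≢_; module ≡-Reasoning)
open import Relation.Nullary.Decidable using (yes; no; does; does-⇔; dec-true; dec-false; ¬?; _×-dec_)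
open import Relation.Nullary.Negation.Core using (contradiction)
open import Relation.Unary using (Pred; Decidable)

-- Polynomials are never divided. Each identity is stated with its denominators multiplied out and
-- then cleared by `unity-cancel`: for m > 0 multiplication by xᵐ - 1 is injective over every
-- commutative ring, so nothing about the degree or the leading coefficient of Φₙ has to be known.
-- Apartness in K serves to invert ζᵏ - 1 and to make ℤ → K injective; all the combinatorics takes
-- place over ℤ. In the counting, the factor y^q - 1 subtracts the block j < p of exponents j r from
-- the block q ≤ j < q + p. As p < q, these are disjoint parts of one window of length q + p, so it
-- is enough to bound all nonzero terms of a progression together, whatever their sign. That the
-- signs agree rests on a p + b q = p q + 1 for a = p′, b = q′. Adding p q to both sides of an
-- equation between a positive and a negative exponent absorbs the offset 1 of the negative box, and
-- leaves two combinations of p and q that uniqueness cannot reconcile.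

-- Products over initial segments of ℕ in a commutative monoid.

module Range {c ℓ} (M : CommutativeMonoid c ℓ) where
  open CommutativeMonoid M
  open CommutativeSemigroupProperties commutativeSemigroup using (interchange)

  fold< : ℕ → (ℕ → Carrier) → Carrier
  fold< zero    f = ε
  fold< (suc n) f = f 0 ∙ fold< n (f ∘ suc)

  fold<-cong : ∀ n {f g} → (∀ i → f i ≈ g i) → fold< n f ≈ fold< n g
  fold<-cong zero    eq = refl
  fold<-cong (suc n) eq = ∙-cong (eq 0) (fold<-cong n (eq ∘ suc))

  fold<-ε : ∀ n {f} → (∀ i → i ℕ.< n → f i ≈ ε) → fold< n f ≈ ε
  fold<-ε zero    eq = refl
  fold<-ε (suc n) eq =
    trans (∙-cong (eq 0 ℕ.z<s) (fold<-ε n λ i i<n → eq (suc i) (ℕ.s<s i<n))) (identityˡ ε)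

  fold<-∙ : ∀ n f g → fold< n (λ i → f i ∙ g i) ≈ fold< n f ∙ fold< n g
  fold<-∙ zero    f g = sym (identityˡ ε)
  fold<-∙ (suc n) f g =
    trans (∙-congˡ (fold<-∙ n (f ∘ suc) (g ∘ suc))) (interchange _ _ _ _)

  fold<-+ : ∀ m n f → fold< (m ℕ.+ n) f ≈ fold< m f ∙ fold< n (f ∘ (m ℕ.+_))
  fold<-+ zero    n f = sym (identityˡ _)
  fold<-+ (suc m) n f = trans (∙-congˡ (fold<-+ m n (f ∘ suc))) (sym (assoc _ _ _))

  fold<-last : ∀ n f → fold< (suc n) f ≈ fold< n f ∙ f n
  fold<-last zero    f = comm _ _
  fold<-last (suc n) f = trans (∙-congˡ (fold<-last n (f ∘ suc))) (sym (assoc _ _ _))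

-- Coefficient lists as a commutative ring, and the polynomials xᵐ - a.

module PolynomialRing {c ℓ} (R : CommutativeRing c ℓ) where
  open CommutativeRing R
  open RingProperties ring using
    (-0#≈0#; -‿distribˡ-*; -‿+-comm; x∙y⁻¹≈ε⇒x≈y; x≈y⇒x∙y⁻¹≈ε)
  open AbelianGroupProperties +-abelianGroup using (xyx⁻¹≈y)
  open CommutativeSemigroupProperties
    (CommutativeMonoid.commutativeSemigroup +-commutativeMonoid) using (interchange)
  open CommutativeSemigroupProperties
    (CommutativeMonoid.commutativeSemigroup *-commutativeMonoid) using (x∙yz≈y∙xz)
  open SetoidReasoning setoid
  open Range +-commutativeMonoid
  open Polynomial rawRing

  -- ⟨ Σ aᵢxⁱ , w ⟩ = Σ aᵢwᵢ.  Multiplication of polynomials is dual to the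
  -- addition of exponents, so the ring laws for _⊗_ reduce to those of ℕ.
  ⟨_,_⟩ : Poly → (ℕ → Carrier) → Carrier
  ⟨ []    , w ⟩ = 0#
  ⟨ a ∷ f , w ⟩ = a * w 0 + ⟨ f , w ∘ suc ⟩

  -- As weights these read off single coefficients; the recursion follows that of `coeff`.
  δ : ℕ → ℕ → Carrier
  δ zero    zero    = 1#
  δ zero    (suc i) = 0#
  δ (suc n) zero    = 0#
  δ (suc n) (suc i) = δ n i

  ⟨⟩-congʳ : ∀ f {v w} → (∀ i → v i ≈ w i) → ⟨ f , v ⟩ ≈ ⟨ f , w ⟩
  ⟨⟩-congʳ []      eq = refl
  ⟨⟩-congʳ (a ∷ f) eq = +-cong (*-congˡ (eq 0)) (⟨⟩-congʳ f (eq ∘ suc))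

  ⟨⟩-zeroʳ : ∀ f → ⟨ f , (λ _ → 0#) ⟩ ≈ 0#
  ⟨⟩-zeroʳ []      = refl
  ⟨⟩-zeroʳ (a ∷ f) = trans (+-cong (zeroʳ a) (⟨⟩-zeroʳ f)) (+-identityˡ 0#)

  ⟨⟩-distribʳ : ∀ f v w → ⟨ f , (λ i → v i + w i) ⟩ ≈ ⟨ f , v ⟩ + ⟨ f , w ⟩
  ⟨⟩-distribʳ []      v w = sym (+-identityˡ 0#)
  ⟨⟩-distribʳ (a ∷ f) v w =
    trans (+-cong (distribˡ a _ _) (⟨⟩-distribʳ f _ _)) (interchange _ _ _ _)

  ⟨⟩-scaleʳ : ∀ f a w → ⟨ f , (λ i → a * w i) ⟩ ≈ a * ⟨ f , w ⟩
  ⟨⟩-scaleʳ []      a w = sym (zeroʳ a)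
  ⟨⟩-scaleʳ (b ∷ f) a w = begin
    b * (a * w 0) + ⟨ f , (λ i → a * w (suc i)) ⟩ ≈⟨ +-cong (x∙yz≈y∙xz b a _) (⟨⟩-scaleʳ f a _) ⟩
    a * (b * w 0) + a * ⟨ f , w ∘ suc ⟩           ≈⟨ distribˡ a _ _ ⟨
    a * (b * w 0 + ⟨ f , w ∘ suc ⟩)               ∎

  ⟨⟩-comm : ∀ f g (h : ℕ → ℕ → Carrier) →
            ⟨ f , (λ i → ⟨ g , (λ j → h i j) ⟩) ⟩ ≈ ⟨ g , (λ j → ⟨ f , (λ i → h i j) ⟩) ⟩
  ⟨⟩-comm []      g h = sym (⟨⟩-zeroʳ g)
  ⟨⟩-comm (a ∷ f) g h = begin
    a * ⟨ g , h 0 ⟩ + ⟨ f , (λ i → ⟨ g , h (suc i) ⟩) ⟩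
      ≈⟨ +-cong (⟨⟩-scaleʳ g a (h 0)) (sym (⟨⟩-comm f g (h ∘ suc) )) ⟨
    ⟨ g , (λ j → a * h 0 j) ⟩ + ⟨ g , (λ j → ⟨ f , (λ i → h (suc i) j) ⟩) ⟩
      ≈⟨ ⟨⟩-distribʳ g _ _ ⟨
    ⟨ g , (λ j → a * h 0 j + ⟨ f , (λ i → h (suc i) j) ⟩) ⟩ ∎

  coeff≈⟨⟩ : ∀ f n → coeff f n ≈ ⟨ f , δ n ⟩
  coeff≈⟨⟩ []      n       = refl
  coeff≈⟨⟩ (a ∷ f) zero    = sym (trans (+-cong (*-identityʳ a) (⟨⟩-zeroʳ f)) (+-identityʳ a))
  coeff≈⟨⟩ (a ∷ f) (suc n) =
    trans (coeff≈⟨⟩ f n) (sym (trans (+-congʳ (zeroʳ a)) (+-identityˡ _)))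

  ⟨⟩-⊕ : ∀ f g w → ⟨ f ⊕ g , w ⟩ ≈ ⟨ f , w ⟩ + ⟨ g , w ⟩
  ⟨⟩-⊕ []      g       w = sym (+-identityˡ _)
  ⟨⟩-⊕ (a ∷ f) []      w = sym (+-identityʳ _)
  ⟨⟩-⊕ (a ∷ f) (b ∷ g) w =
    trans (+-cong (distribʳ (w 0) a b) (⟨⟩-⊕ f g _)) (interchange _ _ _ _)

  ⟨⟩-map-* : ∀ a f w → ⟨ map (a *_) f , w ⟩ ≈ a * ⟨ f , w ⟩
  ⟨⟩-map-* a []      w = sym (zeroʳ a)
  ⟨⟩-map-* a (b ∷ f) w =
    trans (+-cong (*-assoc a b _) (⟨⟩-map-* a f _)) (sym (distribˡ a _ _))

  ⟨⟩-⊗ : ∀ f g w → ⟨ f ⊗ g , w ⟩ ≈ ⟨ f , (λ i → ⟨ g , (λ j → w (i ℕ.+ j)) ⟩) ⟩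
  ⟨⟩-⊗ []      g w = refl
  ⟨⟩-⊗ (a ∷ f) g w = begin
    ⟨ map (a *_) g ⊕ (0# ∷ f ⊗ g) , w ⟩
      ≈⟨ ⟨⟩-⊕ (map (a *_) g) (0# ∷ f ⊗ g) w ⟩
    ⟨ map (a *_) g , w ⟩ + (0# * w 0 + ⟨ f ⊗ g , w ∘ suc ⟩)
      ≈⟨ +-cong (⟨⟩-map-* a g w) (trans (+-congʳ (zeroˡ _)) (+-identityˡ _)) ⟩
    a * ⟨ g , w ⟩ + ⟨ f ⊗ g , w ∘ suc ⟩
      ≈⟨ +-congˡ (⟨⟩-⊗ f g (w ∘ suc)) ⟩
    a * ⟨ g , w ⟩ + ⟨ f , (λ i → ⟨ g , (λ j → w (suc i ℕ.+ j)) ⟩) ⟩ ∎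

  ⟨⟩-const : ∀ a w → ⟨ const a , w ⟩ ≈ a * w 0
  ⟨⟩-const a w = +-identityʳ _

  ⟨⟩-X^ : ∀ n w → ⟨ X^ n , w ⟩ ≈ w n
  ⟨⟩-X^ zero    w = trans (⟨⟩-const 1# w) (*-identityˡ _)
  ⟨⟩-X^ (suc n) w = trans (+-cong (zeroˡ _) (⟨⟩-X^ n (w ∘ suc))) (+-identityˡ _)

  neg : Poly → Poly
  neg f = map -_ f

  ⟨⟩-neg : ∀ f w → ⟨ neg f , w ⟩ ≈ - ⟨ f , w ⟩
  ⟨⟩-neg []      w = sym -0#≈0#
  ⟨⟩-neg (a ∷ f) w = trans (+-cong (sym (-‿distribˡ-* a _)) (⟨⟩-neg f _)) (-‿+-comm _ _)

  infix 4 _≈ᵖ_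
  -- Equivalent to `_≋_`, but in the form in which the ring laws are proved. As a record it lets `f`
  -- and `g` be inferred from the type, which an unfolding family of equations between pairings
  -- would not.
  record _≈ᵖ_ (f g : Poly) : Set (c Level.⊔ ℓ) where
    constructor pairwise
    field pair : ∀ w → ⟨ f , w ⟩ ≈ ⟨ g , w ⟩
  open _≈ᵖ_ public

  ≈ᵖ⇒≋ : ∀ {f g} → f ≈ᵖ g → f ≋ g
  ≈ᵖ⇒≋ {f} {g} eq i = trans (coeff≈⟨⟩ f i) (trans (pair eq (δ i)) (sym (coeff≈⟨⟩ g i)))

  ≋⇒≈ᵖ : ∀ {f g} → f ≋ g → f ≈ᵖ g
  ≋⇒≈ᵖ {f} {g} eq = pairwise (go f g eq)
    where
    go : ∀ f g → f ≋ g → ∀ w → ⟨ f , w ⟩ ≈ ⟨ g , w ⟩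
    go []      []      eq w = refl
    go []      (b ∷ g) eq w = sym (begin
      b * w 0 + ⟨ g , w ∘ suc ⟩ ≈⟨ +-cong (*-congʳ (sym (eq 0))) (sym (go [] g (eq ∘ suc) _)) ⟩
      0# * w 0 + 0#             ≈⟨ trans (+-identityʳ _) (zeroˡ _) ⟩
      0#                        ∎)
    go (a ∷ f) []      eq w = begin
      a * w 0 + ⟨ f , w ∘ suc ⟩ ≈⟨ +-cong (*-congʳ (eq 0)) (go f [] (eq ∘ suc) _) ⟩
      0# * w 0 + 0#             ≈⟨ trans (+-identityʳ _) (zeroˡ _) ⟩
      0#                        ∎
    go (a ∷ f) (b ∷ g) eq w = +-cong (*-congʳ (eq 0)) (go f g (eq ∘ suc) _)

  ⊗-cong : ∀ {f f′ g g′} → f ≈ᵖ f′ → g ≈ᵖ g′ → f ⊗ g ≈ᵖ f′ ⊗ g′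
  ⊗-cong {f} {f′} {g} {g′} p q = pairwise λ w → begin
    ⟨ f ⊗ g , w ⟩   ≈⟨ ⟨⟩-⊗ f g w ⟩
    _               ≈⟨ ⟨⟩-congʳ f (λ i → pair q _) ⟩
    _               ≈⟨ pair p _ ⟩
    _               ≈⟨ ⟨⟩-⊗ f′ g′ w ⟨
    ⟨ f′ ⊗ g′ , w ⟩ ∎

  ⊗-assoc : ∀ f g h → (f ⊗ g) ⊗ h ≈ᵖ f ⊗ (g ⊗ h)
  ⊗-assoc f g h = pairwise λ w → begin
    ⟨ (f ⊗ g) ⊗ h , w ⟩ ≈⟨ ⟨⟩-⊗ (f ⊗ g) h w ⟩
    _                   ≈⟨ ⟨⟩-⊗ f g _ ⟩
    ⟨ f , (λ i → ⟨ g , (λ j → ⟨ h , (λ k → w (i ℕ.+ j ℕ.+ k)) ⟩) ⟩) ⟩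
      ≈⟨ ⟨⟩-congʳ f (λ i → ⟨⟩-congʳ g λ j → ⟨⟩-congʳ h λ k → reflexive (≡.cong w (ℕ.+-assoc i j k))) ⟩
    ⟨ f , (λ i → ⟨ g , (λ j → ⟨ h , (λ k → w (i ℕ.+ (j ℕ.+ k))) ⟩) ⟩) ⟩
      ≈⟨ ⟨⟩-congʳ f (λ i → ⟨⟩-⊗ g h _) ⟨
    _                   ≈⟨ ⟨⟩-⊗ f (g ⊗ h) w ⟨
    ⟨ f ⊗ (g ⊗ h) , w ⟩ ∎

  ⊗-comm : ∀ f g → f ⊗ g ≈ᵖ g ⊗ f
  ⊗-comm f g = pairwise λ w → begin
    ⟨ f ⊗ g , w ⟩ ≈⟨ ⟨⟩-⊗ f g w ⟩
    _             ≈⟨ ⟨⟩-comm f g _ ⟩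
    _             ≈⟨ ⟨⟩-congʳ g (λ j → ⟨⟩-congʳ f λ i → reflexive (≡.cong w (ℕ.+-comm i j))) ⟩
    _             ≈⟨ ⟨⟩-⊗ g f w ⟨
    ⟨ g ⊗ f , w ⟩ ∎

  ⊗-identityˡ : ∀ f → const 1# ⊗ f ≈ᵖ f
  ⊗-identityˡ f = pairwise λ w →
    trans (⟨⟩-⊗ (const 1#) f w) (trans (⟨⟩-const 1# λ i → ⟨ f , (λ j → w (i ℕ.+ j)) ⟩) (*-identityˡ _))

  ⊗-distribʳ : ∀ h f g → (f ⊕ g) ⊗ h ≈ᵖ (f ⊗ h) ⊕ (g ⊗ h)
  ⊗-distribʳ h f g = pairwise λ w → begin
    ⟨ (f ⊕ g) ⊗ h , w ⟩           ≈⟨ ⟨⟩-⊗ (f ⊕ g) h w ⟩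
    _                             ≈⟨ ⟨⟩-⊕ f g _ ⟩
    _                             ≈⟨ +-cong (⟨⟩-⊗ f h w) (⟨⟩-⊗ g h w) ⟨
    ⟨ f ⊗ h , w ⟩ + ⟨ g ⊗ h , w ⟩ ≈⟨ ⟨⟩-⊕ (f ⊗ h) (g ⊗ h) w ⟨
    ⟨ (f ⊗ h) ⊕ (g ⊗ h) , w ⟩     ∎

  ≈ᵖ-refl : ∀ {f} → f ≈ᵖ f
  ≈ᵖ-refl = pairwise λ w → refl

  ≈ᵖ-sym : ∀ {f g} → f ≈ᵖ g → g ≈ᵖ f
  ≈ᵖ-sym p = pairwise λ w → sym (pair p w)

  ≈ᵖ-trans : ∀ {f g h} → f ≈ᵖ g → g ≈ᵖ h → f ≈ᵖ h
  ≈ᵖ-trans p q = pairwise λ w → trans (pair p w) (pair q w)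

  ⊕-⊗-isCommutativeRing : IsCommutativeRing _≈ᵖ_ _⊕_ _⊗_ neg [] (const 1#)
  ⊕-⊗-isCommutativeRing = record
    { isRing = record
      { +-isAbelianGroup = record
        { isGroup = record
          { isMonoid = record
            { isSemigroup = record
              { isMagma = record
                { isEquivalence = record { refl = ≈ᵖ-refl ; sym = ≈ᵖ-sym ; trans = ≈ᵖ-trans }
                ; ∙-cong = λ {f} {f′} {g} {g′} p q → pairwise λ w →
                    trans (⟨⟩-⊕ f g w) (trans (+-cong (pair p w) (pair q w)) (sym (⟨⟩-⊕ f′ g′ w)))
                }
              ; assoc = λ f g h → pairwise λ w → begin
                  ⟨ (f ⊕ g) ⊕ h , w ⟩ ≈⟨ trans (⟨⟩-⊕ (f ⊕ g) h w) (+-congʳ (⟨⟩-⊕ f g w)) ⟩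
                  _                   ≈⟨ +-assoc _ _ _ ⟩
                  _                   ≈⟨ trans (⟨⟩-⊕ f (g ⊕ h) w) (+-congˡ (⟨⟩-⊕ g h w)) ⟨
                  ⟨ f ⊕ (g ⊕ h) , w ⟩ ∎
              }
            ; identity = (λ f → ≈ᵖ-refl) , λ f → pairwise λ w → trans (⟨⟩-⊕ f [] w) (+-identityʳ _)
            }
          ; inverse = (λ f → pairwise λ w → trans (⟨⟩-⊕ (neg f) f w)
                                               (trans (+-congʳ (⟨⟩-neg f w)) (-‿inverseˡ _)))
                    , (λ f → pairwise λ w → trans (⟨⟩-⊕ f (neg f) w)
                                               (trans (+-congˡ (⟨⟩-neg f w)) (-‿inverseʳ _)))
          ; ⁻¹-cong = λ {f} {g} p → pairwise λ w →
              trans (⟨⟩-neg f w) (trans (-‿cong (pair p w)) (sym (⟨⟩-neg g w)))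
          }
        ; comm = λ f g → pairwise λ w →
            trans (⟨⟩-⊕ f g w) (trans (+-comm _ _) (sym (⟨⟩-⊕ g f w)))
        }
      ; *-cong = ⊗-cong
      ; *-assoc = ⊗-assoc
      ; *-identity = ⊗-identityˡ , λ f → ≈ᵖ-trans (⊗-comm f _) (⊗-identityˡ f)
      ; distrib = (λ f g h → pairwise λ w → begin
            ⟨ f ⊗ (g ⊕ h) , w ⟩         ≈⟨ pair (⊗-comm f (g ⊕ h)) w ⟩
            _                           ≈⟨ pair (⊗-distribʳ f g h) w ⟩
            ⟨ (g ⊗ f) ⊕ (h ⊗ f) , w ⟩   ≈⟨ ⟨⟩-⊕ (g ⊗ f) (h ⊗ f) w ⟩
            _                           ≈⟨ +-cong (pair (⊗-comm g f) w) (pair (⊗-comm h f) w) ⟩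
            _                           ≈⟨ ⟨⟩-⊕ (f ⊗ g) (f ⊗ h) w ⟨
            ⟨ (f ⊗ g) ⊕ (f ⊗ h) , w ⟩   ∎)
          , ⊗-distribʳ
      }
    ; *-comm = ⊗-comm
    }

  polynomialRing : CommutativeRing c (c Level.⊔ ℓ)
  polynomialRing = record { isCommutativeRing = ⊕-⊗-isCommutativeRing }

  private
    module P = CommutativeRing polynomialRing
  module PolynomialSum     = Range P.+-commutativeMonoid
  module PolynomialProduct = Range P.*-commutativeMonoid

  δ-refl : ∀ n → δ n n ≈ 1#
  δ-refl zero    = refl
  δ-refl (suc n) = δ-refl n

  δ-≢ : ∀ n i → n ≢ i → δ n i ≈ 0#
  δ-≢ zero    zero    n≢i = contradiction ≡.refl n≢i
  δ-≢ zero    (suc i) n≢i = refl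
  δ-≢ (suc n) zero    n≢i = refl
  δ-≢ (suc n) (suc i) n≢i = δ-≢ n i (n≢i ∘ ≡.cong suc)

  ⟨⟩-⊝ : ∀ f g w → ⟨ f P.- g , w ⟩ ≈ ⟨ f , w ⟩ - ⟨ g , w ⟩
  ⟨⟩-⊝ f g w = trans (⟨⟩-⊕ f (neg g) w) (+-congˡ (⟨⟩-neg g w))

  ⟨⟩-X^⊗ : ∀ n f w → ⟨ X^ n ⊗ f , w ⟩ ≈ ⟨ f , w ∘ (n ℕ.+_) ⟩
  ⟨⟩-X^⊗ n f w = trans (⟨⟩-⊗ (X^ n) f w) (⟨⟩-X^ n λ i → ⟨ f , (λ j → w (i ℕ.+ j)) ⟩)

  ⟨⟩-fold< : ∀ n F w → ⟨ PolynomialSum.fold< n F , w ⟩ ≈ fold< n (λ i → ⟨ F i , w ⟩)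
  ⟨⟩-fold< zero    F w = refl
  ⟨⟩-fold< (suc n) F w = trans (⟨⟩-⊕ (F 0) _ w) (+-congˡ (⟨⟩-fold< n (F ∘ suc) w))

  binomial : ℕ → Carrier → Poly
  binomial m a = X^ m ⊕ const (- a)

  ⟨⟩-binomial : ∀ m a w → ⟨ binomial m a , w ⟩ ≈ w m - a * w 0
  ⟨⟩-binomial m a w = begin
    ⟨ X^ m ⊕ const (- a) , w ⟩         ≈⟨ ⟨⟩-⊕ (X^ m) (const (- a)) w ⟩
    ⟨ X^ m , w ⟩ + ⟨ const (- a) , w ⟩ ≈⟨ +-cong (⟨⟩-X^ m w) (⟨⟩-const (- a) w) ⟩
    w m + - a * w 0                    ≈⟨ +-congˡ (-‿distribˡ-* a (w 0)) ⟨
    w m - a * w 0                      ∎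

  ⟨⟩-binomial⊗ : ∀ m a f w → ⟨ binomial m a ⊗ f , w ⟩ ≈ ⟨ f , w ∘ (m ℕ.+_) ⟩ - a * ⟨ f , w ⟩
  ⟨⟩-binomial⊗ m a f w = trans (⟨⟩-⊗ (binomial m a) f w) (⟨⟩-binomial m a _)

  binomial-cong : ∀ m {a b} → a ≈ b → binomial m a ≈ᵖ binomial m b
  binomial-cong m {a} {b} eq = pairwise λ w →
    trans (⟨⟩-binomial m a w) (trans (+-congˡ (-‿cong (*-congʳ eq))) (sym (⟨⟩-binomial m b w)))

  unity : ℕ → Poly
  unity m = binomial m 1#

  ⟨⟩-unity : ∀ m w → ⟨ unity m , w ⟩ ≈ w m - w 0
  ⟨⟩-unity m w = trans (⟨⟩-binomial m 1# w) (+-congˡ (-‿cong (*-identityˡ _)))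

  ⟨⟩-unity⊗ : ∀ m f w → ⟨ unity m ⊗ f , w ⟩ ≈ ⟨ f , w ∘ (m ℕ.+_) ⟩ - ⟨ f , w ⟩
  ⟨⟩-unity⊗ m f w = trans (⟨⟩-binomial⊗ m 1# f w) (+-congˡ (-‿cong (*-identityˡ _)))

  -- If (xᵐ − 1) f = 0 then pairing f with a weight is invariant under shifting
  -- the weight by m, and δ n becomes 0 once it is shifted beyond n.
  unity-cancel : ∀ m .{{_ : NonZero m}} f g → unity m ⊗ f ≈ᵖ unity m ⊗ g → f ≈ᵖ g
  unity-cancel m f g eq = ≋⇒≈ᵖ λ n → begin
    coeff f n                    ≈⟨ coeff≈⟨⟩ f n ⟩
    ⟨ f , δ n ⟩                  ≈⟨ x∙y⁻¹≈ε⇒x≈y _ _ (begin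
      d (δ n)                      ≈⟨ shifts (suc n) (δ n) ⟨
      d (δ n ∘ (suc n ℕ.* m ℕ.+_)) ≈⟨ +-cong (⟨⟩-congʳ f (vanish n))
                                             (-‿cong (⟨⟩-congʳ g (vanish n))) ⟩
      d (λ _ → 0#)                 ≈⟨ +-cong (⟨⟩-zeroʳ f) (-‿cong (⟨⟩-zeroʳ g)) ⟩
      0# - 0#                      ≈⟨ -‿inverseʳ 0# ⟩
      0#                           ∎) ⟩
    ⟨ g , δ n ⟩                  ≈⟨ coeff≈⟨⟩ g n ⟨
    coeff g n                    ∎
    where
    d : (ℕ → Carrier) → Carrier
    d w = ⟨ f , w ⟩ - ⟨ g , w ⟩

    vanish : ∀ n i → δ n (suc n ℕ.* m ℕ.+ i) ≈ 0#
    vanish n i = δ-≢ n _ (ℕ.<⇒≢ (ℕ.<-≤-trans (ℕ.m≤m*n (suc n) m) (ℕ.m≤m+n _ i)))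

    shift : ∀ w → d (w ∘ (m ℕ.+_)) ≈ d w
    shift w = x∙y⁻¹≈ε⇒x≈y _ _ (begin
      (⟨ f , w ∘ (m ℕ.+_) ⟩ - ⟨ g , w ∘ (m ℕ.+_) ⟩) - (⟨ f , w ⟩ - ⟨ g , w ⟩)
        ≈⟨ +-congˡ (-‿+-comm _ _) ⟨
      _ ≈⟨ interchange _ _ _ _ ⟩
      (⟨ f , w ∘ (m ℕ.+_) ⟩ - ⟨ f , w ⟩) + (- ⟨ g , w ∘ (m ℕ.+_) ⟩ - - ⟨ g , w ⟩)
        ≈⟨ +-congˡ (-‿+-comm _ _) ⟩
      _ ≈⟨ +-cong (⟨⟩-unity⊗ m f w) (-‿cong (⟨⟩-unity⊗ m g w)) ⟨
      ⟨ unity m ⊗ f , w ⟩ - ⟨ unity m ⊗ g , w ⟩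
        ≈⟨ x≈y⇒x∙y⁻¹≈ε (pair eq w) ⟩
      0# ∎)

    shifts : ∀ t w → d (w ∘ (t ℕ.* m ℕ.+_)) ≈ d w
    shifts zero    w = refl
    shifts (suc t) w = begin
      d (w ∘ (suc t ℕ.* m ℕ.+_)) ≈⟨ +-cong (⟨⟩-congʳ f assoc) (-‿cong (⟨⟩-congʳ g assoc)) ⟩
      d (w ∘ (m ℕ.+_) ∘ (t ℕ.* m ℕ.+_)) ≈⟨ shifts t (w ∘ (m ℕ.+_)) ⟩
      d (w ∘ (m ℕ.+_))                  ≈⟨ shift w ⟩
      d w                               ∎
      where
      assoc : ∀ i → w (m ℕ.+ t ℕ.* m ℕ.+ i) ≈ w (m ℕ.+ (t ℕ.* m ℕ.+ i))
      assoc i = reflexive (≡.cong w (ℕ.+-assoc m (t ℕ.* m) i))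

  geometric : ℕ → ℕ → Poly
  geometric e n = PolynomialSum.fold< n (λ i → X^ (i ℕ.* e))

  ⟨⟩-geometric : ∀ e n w → ⟨ geometric e n , w ⟩ ≈ fold< n (λ i → w (i ℕ.* e))
  ⟨⟩-geometric e n w = trans (⟨⟩-fold< n _ w) (fold<-cong n λ i → ⟨⟩-X^ (i ℕ.* e) w)

  unity⊗geometric : ∀ e n → unity e ⊗ geometric e n ≈ᵖ unity (n ℕ.* e)
  unity⊗geometric e n = pairwise λ w → let v = λ i → w (i ℕ.* e) in begin
    ⟨ unity e ⊗ geometric e n , w ⟩ ≈⟨ ⟨⟩-unity⊗ e (geometric e n) w ⟩
    ⟨ geometric e n , w ∘ (e ℕ.+_) ⟩ - ⟨ geometric e n , w ⟩
      ≈⟨ +-cong (⟨⟩-geometric e n _) (-‿cong (⟨⟩-geometric e n w)) ⟩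
    fold< n (v ∘ suc) - fold< n v   ≈⟨ telescope v ⟩
    v n - v 0                       ≈⟨ ⟨⟩-unity (n ℕ.* e) w ⟨
    ⟨ unity (n ℕ.* e) , w ⟩         ∎
    where
    telescope : ∀ v → fold< n (v ∘ suc) - fold< n v ≈ v n - v 0
    telescope v = begin
      fold< n (v ∘ suc) - fold< n v               ≈⟨ +-congʳ (xyx⁻¹≈y (v 0) _) ⟨
      v 0 + fold< n (v ∘ suc) - v 0 - fold< n v   ≈⟨ +-congʳ (+-congʳ (fold<-last n v)) ⟩
      fold< n v + v n - v 0 - fold< n v           ≈⟨ +-congʳ (+-assoc _ _ _) ⟩
      fold< n v + (v n - v 0) - fold< n v         ≈⟨ xyx⁻¹≈y (fold< n v) _ ⟩
      v n - v 0                                   ∎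

-- Factorisation of xᵈ - 1 into linear factors.

module RootsOfUnity {c ℓ} (R : CommutativeRing c ℓ) where
  open CommutativeRing R
  open RingProperties ring using (-0#≈0#; x[y-z]≈xy-xz; +-inverseʳ-unique)
  open CommutativeSemigroupProperties
    (CommutativeMonoid.commutativeSemigroup *-commutativeMonoid) using (x∙yz≈y∙xz)
  open Exp semiring using (_^_)
  open SetoidReasoning setoid
  open Polynomial rawRing
  open PolynomialRing R
  private module P = CommutativeRing polynomialRing
  open PolynomialProduct renaming (fold< to ∏<; fold<-last to ∏<-last)

  linear : Carrier → Poly
  linear = binomial 1

  -- Weighting the coefficients by ξ^i is the substitution x ↦ ξx. Since ξx - ξa = ξ(x - a), each of
  -- the n factors contributes one ξ.
  ∏-linear-dilate : ∀ ξ n (a : ℕ → Carrier) w →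
    ⟨ ∏< n (λ k → linear (ξ * a k)) , (λ i → ξ ^ i * w i) ⟩ ≈
    ξ ^ n * ⟨ ∏< n (λ k → linear (a k)) , w ⟩
  ∏-linear-dilate ξ zero    a w = begin
    ⟨ const 1# , (λ i → ξ ^ i * w i) ⟩ ≈⟨ ⟨⟩-const 1# (λ i → ξ ^ i * w i) ⟩
    1# * (1# * w 0)                    ≈⟨ *-congˡ (⟨⟩-const 1# w) ⟨
    1# * ⟨ const 1# , w ⟩              ∎
  ∏-linear-dilate ξ (suc n) a w = begin
    ⟨ linear (ξ * a 0) ⊗ f , (λ i → ξ ^ i * w i) ⟩
      ≈⟨ ⟨⟩-binomial⊗ 1 (ξ * a 0) f _ ⟩
    ⟨ f , (λ i → ξ * ξ ^ i * w (suc i)) ⟩ - ξ * a 0 * ⟨ f , (λ i → ξ ^ i * w i) ⟩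
      ≈⟨ +-cong (trans (⟨⟩-congʳ f λ i → *-assoc ξ _ _) (⟨⟩-scaleʳ f ξ _))
                (-‿cong (*-assoc ξ _ _)) ⟩
    ξ * ⟨ f , (λ i → ξ ^ i * w (suc i)) ⟩ - ξ * (a 0 * ⟨ f , (λ i → ξ ^ i * w i) ⟩)
      ≈⟨ x[y-z]≈xy-xz ξ _ _ ⟨
    ξ * (⟨ f , (λ i → ξ ^ i * w (suc i)) ⟩ - a 0 * ⟨ f , (λ i → ξ ^ i * w i) ⟩)
      ≈⟨ *-congˡ (+-cong (∏-linear-dilate ξ n (a ∘ suc) (w ∘ suc))
                         (-‿cong (trans (*-congˡ (∏-linear-dilate ξ n (a ∘ suc) w))
                                        (x∙yz≈y∙xz _ _ _)))) ⟩
    ξ * (ξ ^ n * ⟨ g , w ∘ suc ⟩ - ξ ^ n * (a 0 * ⟨ g , w ⟩))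
      ≈⟨ *-congˡ (x[y-z]≈xy-xz (ξ ^ n) _ _) ⟨
    ξ * (ξ ^ n * (⟨ g , w ∘ suc ⟩ - a 0 * ⟨ g , w ⟩))
      ≈⟨ *-assoc ξ _ _ ⟨
    ξ * ξ ^ n * (⟨ g , w ∘ suc ⟩ - a 0 * ⟨ g , w ⟩)
      ≈⟨ *-congˡ (⟨⟩-binomial⊗ 1 (a 0) g w) ⟨
    ξ * ξ ^ n * ⟨ linear (a 0) ⊗ g , w ⟩ ∎
    where
    f g : Poly
    f = ∏< n (λ k → linear (ξ * a (suc k)))
    g = ∏< n (λ k → linear (a (suc k)))

  -- The product is monic of degree n, so a weight that vanishes below n sees only the leading
  -- coefficient.
  ∏-linear-monic : ∀ n (a : ℕ → Carrier) w → (∀ i → i ℕ.< n → w i ≈ 0#) → ⟨ ∏< n (λ k → linear (a k)) , w ⟩ ≈ w n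
  ∏-linear-monic zero    a w w≈0 = trans (⟨⟩-const 1# w) (*-identityˡ _)
  ∏-linear-monic (suc n) a w w≈0 = begin
    ⟨ linear (a 0) ⊗ f , w ⟩          ≈⟨ ⟨⟩-binomial⊗ 1 (a 0) f w ⟩
    ⟨ f , w ∘ suc ⟩ - a 0 * ⟨ f , w ⟩
      ≈⟨ +-cong (∏-linear-monic n (a ∘ suc) (w ∘ suc) (λ i i<n → w≈0 (suc i) (ℕ.s<s i<n)))
                (-‿cong (*-congˡ (trans (∏-linear-monic n (a ∘ suc) w (λ i i<n → w≈0 i (ℕ.m<n⇒m<1+n i<n)))
                                        (w≈0 n ℕ.≤-refl)))) ⟩
    w (suc n) - a 0 * 0#              ≈⟨ +-congˡ (trans (-‿cong (zeroʳ _)) -0#≈0#) ⟩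
    w (suc n) + 0#                    ≈⟨ +-identityʳ _ ⟩
    w (suc n)                         ∎
    where f = ∏< n (λ k → linear (a (suc k)))

  -- The product is fixed by x ↦ ξx, which kills its middle coefficients.  The
  -- constant term is then determined by the root 1.
  ∏-linear-powers : ∀ ξ d .{{_ : NonZero d}} → ξ ^ d ≈ 1# →
    (∀ k → 0 ℕ.< k → k ℕ.< d → ∀ x → ξ ^ k * x ≈ x → x ≈ 0#) →
    ∏< d (λ k → linear (ξ ^ suc k)) ≈ᵖ unity d
  ∏-linear-powers ξ d@(suc d-1) ξ^d≈1 regular = P.trans P≈ (P.+-congˡ {X^ d} (pairwise {const p₀} {const (- 1#)} λ w →
      trans (⟨⟩-const p₀ w) (trans (*-congʳ p₀≈-1) (sym (⟨⟩-const (- 1#) w)))))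
    where
    P P′ : Poly
    P  = ∏< d (λ k → linear (ξ ^ suc k))
    P′ = ∏< d (λ k → linear (ξ ^ k))

    -- The exponents 1, ..., d and 0, ..., d - 1 give the same factors because ξᵈ = ξ⁰. Dilation by
    -- ξ turns the second list of roots into the first.
    P≈P′ : P ≈ᵖ P′
    P≈P′ = P.trans (∏<-last d-1 _) (P.trans (P.*-comm _ _) (P.*-congʳ (binomial-cong 1 ξ^d≈1)))

    fixed : ∀ w → ⟨ P , (λ i → ξ ^ i * w i) ⟩ ≈ ⟨ P , w ⟩
    fixed w = begin
      ⟨ P , (λ i → ξ ^ i * w i) ⟩ ≈⟨ ∏-linear-dilate ξ d (ξ ^_) w ⟩
      ξ ^ d * ⟨ P′ , w ⟩          ≈⟨ *-congʳ ξ^d≈1 ⟩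
      1# * ⟨ P′ , w ⟩             ≈⟨ *-identityˡ _ ⟩
      ⟨ P′ , w ⟩                  ≈⟨ pair P≈P′ w ⟨
      ⟨ P , w ⟩                   ∎

    δ-dilate : ∀ n i → ξ ^ i * δ n i ≈ ξ ^ n * δ n i
    δ-dilate n i with n ℕ.≟ i
    ... | yes ≡.refl = refl
    ... | no  n≢i    = trans (*-congˡ (δ-≢ n i n≢i))
                         (trans (zeroʳ _) (sym (trans (*-congˡ (δ-≢ n i n≢i)) (zeroʳ _))))

    middle : ∀ n → 0 ℕ.< n → n ℕ.< d → ⟨ P , δ n ⟩ ≈ 0#
    middle n 0<n n<d = regular n 0<n n<d _ (begin
      ξ ^ n * ⟨ P , δ n ⟩           ≈⟨ ⟨⟩-scaleʳ P (ξ ^ n) (δ n) ⟨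
      ⟨ P , (λ i → ξ ^ n * δ n i) ⟩ ≈⟨ ⟨⟩-congʳ P (δ-dilate n) ⟨
      ⟨ P , (λ i → ξ ^ i * δ n i) ⟩ ≈⟨ fixed (δ n) ⟩
      ⟨ P , δ n ⟩                   ∎)

    p₀ : Carrier
    p₀ = ⟨ P , δ 0 ⟩

    ⟨⟩-X^⊕const : ∀ w → ⟨ X^ d ⊕ const p₀ , w ⟩ ≈ w d + p₀ * w 0
    ⟨⟩-X^⊕const w = trans (⟨⟩-⊕ (X^ d) (const p₀) w) (+-cong (⟨⟩-X^ d w) (⟨⟩-const p₀ w))

    δ-above : ∀ n → d ℕ.≤ n → δ n d ≈ ⟨ P , δ n ⟩
    δ-above n d≤n = sym (∏-linear-monic d (λ k → ξ ^ suc k) (δ n) λ i i<d →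
      δ-≢ n i (ℕ.>⇒≢ (ℕ.<-≤-trans i<d d≤n)))

    value : ∀ n → ⟨ P , δ n ⟩ ≈ δ n d + p₀ * δ n 0
    value zero      = sym (trans (+-identityˡ _) (*-identityʳ p₀))
    value n@(suc _) = begin
      ⟨ P , δ n ⟩       ≈⟨ go ⟩
      δ n d             ≈⟨ +-identityʳ _ ⟨
      δ n d + 0#        ≈⟨ +-congˡ (zeroʳ p₀) ⟨
      δ n d + p₀ * 0#   ∎
      where
      go : ⟨ P , δ n ⟩ ≈ δ n d
      go with n ℕ.<? d
      ... | yes n<d = trans (middle n ℕ.z<s n<d) (sym (δ-≢ n d (ℕ.<⇒≢ n<d)))
      ... | no  n≮d = sym (δ-above n (ℕ.≮⇒≥ n≮d))

    P≋ : P ≋ X^ d ⊕ const p₀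
    P≋ n = begin
      coeff P n                   ≈⟨ coeff≈⟨⟩ P n ⟩
      ⟨ P , δ n ⟩                 ≈⟨ value n ⟩
      δ n d + p₀ * δ n 0          ≈⟨ ⟨⟩-X^⊕const (δ n) ⟨
      ⟨ X^ d ⊕ const p₀ , δ n ⟩   ≈⟨ coeff≈⟨⟩ (X^ d ⊕ const p₀) n ⟨
      coeff (X^ d ⊕ const p₀) n   ∎

    P≈ : P ≈ᵖ X^ d ⊕ const p₀
    P≈ = ≋⇒≈ᵖ P≋

    -- The constant weight 1 evaluates at x = 1, where `P′` vanishes because its first factor is x -
    -- ξ⁰.
    p₀≈-1 : p₀ ≈ - 1#
    p₀≈-1 = +-inverseʳ-unique 1# p₀ (begin
      1# + p₀                                 ≈⟨ +-congˡ (*-identityʳ p₀) ⟨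
      1# + p₀ * 1#                            ≈⟨ ⟨⟩-X^⊕const (λ _ → 1#) ⟨
      ⟨ X^ d ⊕ const p₀ , (λ _ → 1#) ⟩        ≈⟨ pair P≈ _ ⟨
      ⟨ P , (λ _ → 1#) ⟩                      ≈⟨ pair P≈P′ _ ⟩
      ⟨ unity 1 ⊗ f , (λ _ → 1#) ⟩            ≈⟨ ⟨⟩-unity⊗ 1 f _ ⟩
      ⟨ f , (λ _ → 1#) ⟩ - ⟨ f , (λ _ → 1#) ⟩ ≈⟨ -‿inverseʳ _ ⟩
      0#                                      ∎)
      where f = ∏< d-1 (λ k → linear (ξ ^ suc k))

-- Coprimality to p q r in terms of divisibility by the three primes.

∤⇒coprime : ∀ {p k} → Prime p → p ∤ k → Coprime k p
∤⇒coprime p-prime p∤k (d∣k , d∣p) with prime⇒irreducible p-prime d∣p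
... | inj₁ d≡1    = d≡1
... | inj₂ ≡.refl = contradiction d∣k p∤k

coprime⇒∤ : ∀ {p k} → Prime p → Coprime k p → p ∤ k
coprime⇒∤ p-prime k⊥p p∣k = ¬prime[1] (≡.subst Prime (k⊥p (p∣k , ℕ.∣-refl)) p-prime)

coprime-∣ʳ : ∀ {k m n} → Coprime k n → m ∣ n → Coprime k m
coprime-∣ʳ k⊥n m∣n (d∣k , d∣m) = k⊥n (d∣k , ℕ.∣-trans d∣m m∣n)

coprime-*ʳ : ∀ {k m n} → Coprime k m → Coprime k n → Coprime k (m ℕ.* n)
coprime-*ʳ k⊥m k⊥n (d∣k , d∣mn) =
  k⊥n (d∣k , coprime-divisor (Coprimality.sym (coprime-∣ʳ (Coprimality.sym k⊥m) d∣k)) d∣mn)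

coprime-∣* : ∀ {m n k} → Coprime m n → m ∣ k → n ∣ k → m ℕ.* n ∣ k
coprime-∣* {m} {n} m⊥n (divides t ≡.refl) n∣tm =
  ≡.subst (_∣ t ℕ.* m) (ℕ.*-comm n m)
    (ℕ.*-monoˡ-∣ m (coprime-divisor (Coprimality.sym m⊥n) (≡.subst (n ∣_) (ℕ.*-comm t m) n∣tm)))

-- Stated for truth values, as is `does-coprime`: rewriting with both reduces the comparison of
-- factors at an exponent k to the three bits p ∣ k, q ∣ k, r ∣ k.
does-∣-* : ∀ {m n} k → Coprime m n → does (m ℕ.* n ∣? k) ≡ does (m ∣? k) ∧ does (n ∣? k)
does-∣-* {m} {n} k m⊥n = does-⇔
  (mk⇔ (λ mn∣k → ℕ.∣-trans (ℕ.m∣m*n n) mn∣k , ℕ.∣-trans (ℕ.n∣m*n m) mn∣k)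
       (λ (m∣k , n∣k) → coprime-∣* m⊥n m∣k n∣k))
  (m ℕ.* n ∣? k) (m ∣? k ×-dec n ∣? k)

does-coprime : ∀ {p q r} k → Prime p → Prime q → Prime r →
  does (coprime? k (p ℕ.* q ℕ.* r)) ≡
  (not (does (p ∣? k)) ∧ not (does (q ∣? k))) ∧ not (does (r ∣? k))
does-coprime {p} {q} {r} k p-prime q-prime r-prime = does-⇔ (mk⇔ to from)
  (coprime? k (p ℕ.* q ℕ.* r)) ((¬? (p ∣? k) ×-dec ¬? (q ∣? k)) ×-dec ¬? (r ∣? k))
  where
  to : Coprime k (p ℕ.* q ℕ.* r) → (p ∤ k × q ∤ k) × r ∤ k
  to k⊥pqr = ( coprime⇒∤ p-prime (coprime-∣ʳ k⊥pqr (ℕ.∣m⇒∣m*n r (ℕ.m∣m*n q)))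
             , coprime⇒∤ q-prime (coprime-∣ʳ k⊥pqr (ℕ.∣m⇒∣m*n r (ℕ.n∣m*n p))))
           , coprime⇒∤ r-prime (coprime-∣ʳ k⊥pqr (ℕ.n∣m*n (p ℕ.* q)))

  from : (p ∤ k × q ∤ k) × r ∤ k → Coprime k (p ℕ.* q ℕ.* r)
  from ((p∤k , q∤k) , r∤k) =
    coprime-*ʳ (coprime-*ʳ (∤⇒coprime p-prime p∤k) (∤⇒coprime q-prime q∤k)) (∤⇒coprime r-prime r∤k)

-- Inclusion-exclusion for indexed products.

module RangeDivisibility {c ℓ} (M : CommutativeMonoid c ℓ) where
  open CommutativeMonoid M
  open Range M
  open CommutativeMonoidSolver M using (prove; var) renaming (_⊕_ to _:∙_; id to :ε)
  open SetoidReasoning setoid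

  when : Bool → Carrier → Carrier
  when b x = if b then x else ε

  -- Among e consecutive values of `suc t`, starting after a multiple of e, only the last is a
  -- multiple of e; the range splits into d such blocks.
  fold<-multiples : ∀ d e .{{_ : NonZero e}} (f : ℕ → Carrier) →
    fold< (d ℕ.* e) (λ t → when (does (e ∣? suc t)) (f (suc t))) ≈ fold< d (λ k → f (suc k ℕ.* e))
  fold<-multiples zero    e         f = refl
  fold<-multiples (suc d) e@(suc e-1) f = begin
    fold< (e ℕ.+ d ℕ.* e) F             ≈⟨ fold<-+ e (d ℕ.* e) F ⟩
    fold< e F ∙ fold< (d ℕ.* e) (F ∘ (e ℕ.+_)) ≈⟨ ∙-cong first rest ⟩
    f (1 ℕ.* e) ∙ fold< d (λ k → f (suc (suc k) ℕ.* e)) ∎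
    where
    F : ℕ → Carrier
    F t = when (does (e ∣? suc t)) (f (suc t))

    first : fold< e F ≈ f (1 ℕ.* e)
    first = begin
      fold< e F            ≈⟨ fold<-last e-1 F ⟩
      fold< e-1 F ∙ F e-1  ≈⟨ ∙-congʳ (fold<-ε e-1 λ t t<e-1 → reflexive (≡.cong (λ b → when b (f (suc t)))
                                (dec-false (e ∣? suc t) (ℕ.>⇒∤ (ℕ.s<s t<e-1))))) ⟩
      ε ∙ F e-1            ≈⟨ identityˡ _ ⟩
      F e-1                ≡⟨ ≡.cong (λ b → when b (f e)) (dec-true (e ∣? e) ℕ.∣-refl) ⟩
      f e                  ≡⟨ ≡.cong f (ℕ.*-identityˡ e) ⟨
      f (1 ℕ.* e)          ∎

    rest : fold< (d ℕ.* e) (F ∘ (e ℕ.+_)) ≈ fold< d (λ k → f (suc (suc k) ℕ.* e))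
    rest = begin
      fold< (d ℕ.* e) (F ∘ (e ℕ.+_))
        ≈⟨ fold<-cong (d ℕ.* e) (λ t → reflexive (≡.cong₂ when
             (does-⇔ (mk⇔ (λ e∣ → ℕ.∣m+n∣m⇒∣n (≡.subst (e ∣_) (≡.sym (ℕ.+-suc e t)) e∣) ℕ.∣-refl)
                          (λ e∣ → ≡.subst (e ∣_) (ℕ.+-suc e t) (ℕ.∣m∣n⇒∣m+n ℕ.∣-refl e∣)))
                     (e ∣? suc (e ℕ.+ t)) (e ∣? suc t))
             (≡.cong f (≡.sym (ℕ.+-suc e t))))) ⟩
      fold< (d ℕ.* e) (λ t → when (does (e ∣? suc t)) (f (e ℕ.+ suc t)))
        ≈⟨ fold<-multiples d e (f ∘ (e ℕ.+_)) ⟩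
      fold< d (λ k → f (suc (suc k) ℕ.* e)) ∎

  -- A monoid has no inverses, so the terms of negative sign in the usual formula stand on the left,
  -- beside the term for none of the three conditions.
  inclusion-exclusion : ∀ a b c x →
    when ((not a ∧ not b) ∧ not c) x ∙
      (when c x ∙ (when b x ∙ (when a x ∙ when ((a ∧ b) ∧ c) x))) ≈
    x ∙ (when (b ∧ c) x ∙ (when (a ∧ c) x ∙ when (a ∧ b) x))
  inclusion-exclusion = λ where
      false false false x → prove 1 (v :∙ (:ε :∙ (:ε :∙ (:ε :∙ :ε)))) (v :∙ (:ε :∙ (:ε :∙ :ε))) (x Vec.∷ Vec.[])
      false false true  x → prove 1 (:ε :∙ (v :∙ (:ε :∙ (:ε :∙ :ε)))) (v :∙ (:ε :∙ (:ε :∙ :ε))) (x Vec.∷ Vec.[])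
      false true  false x → prove 1 (:ε :∙ (:ε :∙ (v :∙ (:ε :∙ :ε)))) (v :∙ (:ε :∙ (:ε :∙ :ε))) (x Vec.∷ Vec.[])
      false true  true  x → prove 1 (:ε :∙ (v :∙ (v :∙ (:ε :∙ :ε)))) (v :∙ (v :∙ (:ε :∙ :ε))) (x Vec.∷ Vec.[])
      true  false false x → prove 1 (:ε :∙ (:ε :∙ (:ε :∙ (v :∙ :ε)))) (v :∙ (:ε :∙ (:ε :∙ :ε))) (x Vec.∷ Vec.[])
      true  false true  x → prove 1 (:ε :∙ (v :∙ (:ε :∙ (v :∙ :ε)))) (v :∙ (:ε :∙ (v :∙ :ε))) (x Vec.∷ Vec.[])
      true  true  false x → prove 1 (:ε :∙ (:ε :∙ (v :∙ (v :∙ :ε)))) (v :∙ (:ε :∙ (:ε :∙ v))) (x Vec.∷ Vec.[])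
      true  true  true  x → prove 1 (:ε :∙ (v :∙ (v :∙ (v :∙ v)))) (v :∙ (v :∙ (v :∙ v))) (x Vec.∷ Vec.[])
    where v = var 0F

  fold<-balance : ∀ n (f₁ f₂ f₃ f₄ f₅ g₁ g₂ g₃ g₄ : ℕ → Carrier) →
    (∀ t → f₁ t ∙ (f₂ t ∙ (f₃ t ∙ (f₄ t ∙ f₅ t))) ≈ g₁ t ∙ (g₂ t ∙ (g₃ t ∙ g₄ t))) →
    fold< n f₁ ∙ (fold< n f₂ ∙ (fold< n f₃ ∙ (fold< n f₄ ∙ fold< n f₅))) ≈
    fold< n g₁ ∙ (fold< n g₂ ∙ (fold< n g₃ ∙ fold< n g₄))
  fold<-balance n f₁ f₂ f₃ f₄ f₅ g₁ g₂ g₃ g₄ balanced = begin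
    fold< n f₁ ∙ (fold< n f₂ ∙ (fold< n f₃ ∙ (fold< n f₄ ∙ fold< n f₅)))
      ≈⟨ ∙-congˡ (∙-congˡ (∙-congˡ (fold<-∙ n f₄ f₅))) ⟨
    fold< n f₁ ∙ (fold< n f₂ ∙ (fold< n f₃ ∙ fold< n _))
      ≈⟨ ∙-congˡ (∙-congˡ (fold<-∙ n f₃ _)) ⟨
    fold< n f₁ ∙ (fold< n f₂ ∙ fold< n _)
      ≈⟨ ∙-congˡ (fold<-∙ n f₂ _) ⟨
    fold< n f₁ ∙ fold< n _
      ≈⟨ fold<-∙ n f₁ _ ⟨
    fold< n (λ t → f₁ t ∙ (f₂ t ∙ (f₃ t ∙ (f₄ t ∙ f₅ t))))
      ≈⟨ fold<-cong n balanced ⟩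
    fold< n (λ t → g₁ t ∙ (g₂ t ∙ (g₃ t ∙ g₄ t)))
      ≈⟨ fold<-∙ n g₁ _ ⟩
    fold< n g₁ ∙ fold< n _
      ≈⟨ ∙-congˡ (fold<-∙ n g₂ _) ⟩
    fold< n g₁ ∙ (fold< n g₂ ∙ fold< n _)
      ≈⟨ ∙-congˡ (∙-congˡ (fold<-∙ n g₃ g₄)) ⟩
    fold< n g₁ ∙ (fold< n g₂ ∙ (fold< n g₃ ∙ fold< n g₄)) ∎

-- The Möbius formula for Φ_pqr over K.

module CyclotomicFactorisation {c ℓ₁ ℓ₂} (K : HeytingField c ℓ₁ ℓ₂) where
  open Cyclotomic K
  open HeytingField K using (_#_; #⇒invertible; heytingCommutativeRing)
  private
    R = HeytingCommutativeRing.commutativeRing heytingCommutativeRing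
  open CommutativeRing R
  open RingProperties ring using ([y-z]x≈yx-zx; x≈y⇒x∙y⁻¹≈ε)
  open Exp semiring using (_^_; ^-assocʳ; ^-congʳ)
  open Polynomial rawRing
  open PolynomialRing R
  open RootsOfUnity R
  private module P = CommutativeRing polynomialRing
  open PolynomialProduct renaming (fold< to ∏<; fold<-cong to ∏<-cong)
  open RangeDivisibility P.*-commutativeMonoid using (when; inclusion-exclusion)
    renaming (fold<-multiples to ∏<-multiples; fold<-balance to ∏<-balance)

  #1⇒regular : ∀ {a} → a # 1# → ∀ x → a * x ≈ x → x ≈ 0#
  #1⇒regular {a} a#1 x ax≈x = let (u , u[a-1]≈1 , _) = #⇒invertible a#1 in begin
    x                  ≈⟨ *-identityˡ x ⟨
    1# * x             ≈⟨ *-congʳ u[a-1]≈1 ⟨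
    u * (a - 1#) * x   ≈⟨ *-assoc u _ x ⟩
    u * ((a - 1#) * x) ≈⟨ *-congˡ ([y-z]x≈yx-zx x a 1#) ⟩
    u * (a * x - 1# * x) ≈⟨ *-congˡ (x≈y⇒x∙y⁻¹≈ε (trans ax≈x (sym (*-identityˡ x)))) ⟩
    u * 0#             ≈⟨ zeroʳ u ⟩
    0#                 ∎
    where open SetoidReasoning setoid

  primitive-power : ∀ {d e ζ} .{{_ : NonZero e}} → IsPrimitiveRoot (d ℕ.* e) ζ → IsPrimitiveRoot d (ζ ^ e)
  primitive-power {d} {e} {ζ} prim = record
    { root  = trans (power d) (IsPrimitiveRoot.root prim)
    ; exact = λ k 0<k k<d → #-congʳ (sym (power k))
        (IsPrimitiveRoot.exact prim (k ℕ.* e)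
          (ℕ.<-≤-trans 0<k (ℕ.m≤m*n k e)) (ℕ.*-monoˡ-< e k<d))
    }
    where
    open HeytingCommutativeRingProperties heytingCommutativeRing using (#-congʳ)

    power : ∀ k → (ζ ^ e) ^ k ≈ ζ ^ (k ℕ.* e)
    power k = trans (^-assocʳ ζ e k) (^-congʳ ζ (ℕ.*-comm e k))

  ∏-primitive : ∀ d .{{_ : NonZero d}} {ξ} → IsPrimitiveRoot d ξ → ∏< d (λ k → linear (ξ ^ suc k)) ≈ᵖ unity d
  ∏-primitive d {ξ} prim = ∏-linear-powers ξ d (IsPrimitiveRoot.root prim)
    (λ k 0<k k<d → #1⇒regular (IsPrimitiveRoot.exact prim k 0<k k<d))

  -- The surviving exponents are k e with 1 ≤ k ≤ d, so the roots are the powers of ζᵉ, which is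
  -- primitive of order d.
  ∏-divisible : ∀ {n} d e .{{_ : NonZero d}} .{{_ : NonZero e}} {ζ} → n ≡ d ℕ.* e → IsPrimitiveRoot n ζ →
    ∏< n (λ t → when (does (e ∣? suc t)) (linear (ζ ^ suc t))) ≈ᵖ unity d
  ∏-divisible d e {ζ} ≡.refl prim = begin
    ∏< (d ℕ.* e) (λ t → when (does (e ∣? suc t)) (linear (ζ ^ suc t)))
      ≈⟨ ∏<-multiples d e (λ k → linear (ζ ^ k)) ⟩
    ∏< d (λ k → linear (ζ ^ (suc k ℕ.* e)))
      ≈⟨ ∏<-cong d (λ k → binomial-cong 1 (trans (^-assocʳ ζ e (suc k)) (^-congʳ ζ (ℕ.*-comm e (suc k))))) ⟨
    ∏< d (λ k → linear ((ζ ^ e) ^ suc k))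
      ≈⟨ ∏-primitive d (primitive-power prim) ⟩
    unity d ∎
    where open SetoidReasoning P.setoid

  ∏-filter : ∀ {p} {A : Set} {Q : Pred A p} (Q? : Decidable Q) (f : A → Poly) xs →
    ∏ (map f (filter Q? xs)) ≈ᵖ ∏ (map (λ x → when (does (Q? x)) (f x)) xs)
  ∏-filter Q? f []       = P.refl
  ∏-filter Q? f (x ∷ xs) with does (Q? x)
  ... | true  = ⊗-cong {f x} P.refl (∏-filter Q? f xs)
  ... | false = P.trans (∏-filter Q? f xs) (P.sym (P.*-identityˡ _))

  ∏-applyUpTo : ∀ (f : ℕ → Poly) n → ∏ (applyUpTo f n) ≡ ∏< n f
  ∏-applyUpTo f zero    = ≡.refl
  ∏-applyUpTo f (suc n) = ≡.cong (f 0 ⊗_) (∏-applyUpTo (f ∘ suc) n)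

  -- Factors dropped by `filter` become 1, so that all products run over the same range and can be
  -- compared factor by factor.
  Φ-as-product : ∀ n ζ → Φ n ζ ≈ᵖ ∏< n (λ t → when (does (coprime? (suc t) n)) (linear (ζ ^ suc t)))
  Φ-as-product n ζ = begin
    Φ n ζ                              ≈⟨ ∏-filter (λ k → coprime? k n) _ (map suc (upTo n)) ⟩
    ∏ (map g (map suc (upTo n)))       ≡⟨ ≡.cong ∏ (List.map-∘ (upTo n)) ⟨
    ∏ (map (g ∘ suc) (upTo n))         ≡⟨ ≡.cong ∏ (List.map-upTo (g ∘ suc) n) ⟩
    ∏ (applyUpTo (g ∘ suc) n)          ≡⟨ ∏-applyUpTo (g ∘ suc) n ⟩
    ∏< n (g ∘ suc)                     ∎
    where
    open SetoidReasoning P.setoid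
    g : ℕ → Poly
    g k = when (does (coprime? k n)) (linear (ζ ^ k))

  -- Möbius inversion: Φₙ is the product of the powers (x^(n/d) - 1)^μ(d) over the divisors d of n.
  -- The factors with μ(d) = -1, for d = r, q, p and p q r, are moved to the left.
  Φ-pqr : ∀ {p q r} → Prime p → Prime q → Prime r →
    Coprime p q → Coprime p r → Coprime q r →
    .{{_ : NonZero p}} .{{_ : NonZero q}} .{{_ : NonZero r}} →
    ∀ {ζ} → IsPrimitiveRoot (p ℕ.* q ℕ.* r) ζ →
    Φ (p ℕ.* q ℕ.* r) ζ ⊗ (unity (p ℕ.* q) ⊗ (unity (p ℕ.* r) ⊗ (unity (q ℕ.* r) ⊗ unity 1))) ≈ᵖ
    unity (p ℕ.* q ℕ.* r) ⊗ (unity p ⊗ (unity q ⊗ unity r))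
  Φ-pqr {p} {q} {r} p-prime q-prime r-prime p⊥q p⊥r q⊥r {ζ} prim = begin
    Φ n ζ ⊗ (unity (p ℕ.* q) ⊗ (unity (p ℕ.* r) ⊗ (unity (q ℕ.* r) ⊗ unity 1)))
      ≈⟨ P.*-cong (Φ-as-product n ζ)
        (P.*-cong (P.sym (∏-divisible (p ℕ.* q) r ≡.refl prim))
        (P.*-cong (P.sym (∏-divisible (p ℕ.* r) q (swap p q r) prim))
        (P.*-cong (P.sym (∏-divisible (q ℕ.* r) p (rotate p q r) prim))
                  (P.sym (∏-divisible 1 n (≡.sym (ℕ.*-identityˡ n)) prim))))) ⟩
    ∏< n tot ⊗ (∏< n (mul r) ⊗ (∏< n (mul q) ⊗ (∏< n (mul p) ⊗ ∏< n (mul n))))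
      ≈⟨ ∏<-balance n tot (mul r) (mul q) (mul p) (mul n) all (mul (q ℕ.* r)) (mul (p ℕ.* r)) (mul (p ℕ.* q))
           (λ t → pointwise (suc t) (linear (ζ ^ suc t))) ⟩
    ∏< n all ⊗ (∏< n (mul (q ℕ.* r)) ⊗ (∏< n (mul (p ℕ.* r)) ⊗ ∏< n (mul (p ℕ.* q))))
      ≈⟨ P.*-cong (∏-primitive n prim)
        (P.*-cong (∏-divisible p (q ℕ.* r) (ℕ.*-assoc p q r) prim)
        (P.*-cong (∏-divisible q (p ℕ.* r) (≡.trans (≡.cong (ℕ._* r) (ℕ.*-comm p q)) (ℕ.*-assoc q p r)) prim)
                  (∏-divisible r (p ℕ.* q) (ℕ.*-comm (p ℕ.* q) r) prim))) ⟩
    unity n ⊗ (unity p ⊗ (unity q ⊗ unity r)) ∎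
    where
    open SetoidReasoning P.setoid
    n = p ℕ.* q ℕ.* r

    instance
      pq≢0 : NonZero (p ℕ.* q)
      pq≢0 = ℕ.m*n≢0 p q
      pr≢0 : NonZero (p ℕ.* r)
      pr≢0 = ℕ.m*n≢0 p r
      qr≢0 : NonZero (q ℕ.* r)
      qr≢0 = ℕ.m*n≢0 q r
      n≢0 : NonZero n
      n≢0 = ℕ.m*n≢0 (p ℕ.* q) r

    swap : ∀ a b c → a ℕ.* b ℕ.* c ≡ a ℕ.* c ℕ.* b
    swap a b c = ≡.trans (ℕ.*-assoc a b c) (≡.trans (≡.cong (a ℕ.*_) (ℕ.*-comm b c)) (≡.sym (ℕ.*-assoc a c b)))

    rotate : ∀ a b c → a ℕ.* b ℕ.* c ≡ b ℕ.* c ℕ.* a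
    rotate a b c = ≡.trans (ℕ.*-assoc a b c) (ℕ.*-comm a (b ℕ.* c))

    tot all : ℕ → Poly
    tot t = when (does (coprime? (suc t) n)) (linear (ζ ^ suc t))
    all t = linear (ζ ^ suc t)

    mul : ℕ → ℕ → Poly
    mul e t = when (does (e ∣? suc t)) (linear (ζ ^ suc t))

    pointwise : ∀ k x →
      when (does (coprime? k n)) x ⊗
        (when (does (r ∣? k)) x ⊗ (when (does (q ∣? k)) x ⊗ (when (does (p ∣? k)) x ⊗ when (does (n ∣? k)) x))) ≈ᵖ
      x ⊗ (when (does (q ℕ.* r ∣? k)) x ⊗ (when (does (p ℕ.* r ∣? k)) x ⊗ when (does (p ℕ.* q ∣? k)) x))
    pointwise k x rewrite does-coprime k p-prime q-prime r-prime
                        | does-∣-* k (Coprimality.sym (coprime-*ʳ (Coprimality.sym p⊥r) (Coprimality.sym q⊥r)))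
                        | does-∣-* k p⊥q | does-∣-* k p⊥r | does-∣-* k q⊥r =
      inclusion-exclusion (does (p ∣? k)) (does (q ∣? k)) (does (r ∣? k)) x

-- Transfer of polynomial identities from ℤ to K.

module ℤ[x] where
  open Polynomial ℤ.+-*-rawRing public
  open PolynomialRing ℤ.+-*-commutativeRing public

module IntegerPolynomials {c ℓ₁ ℓ₂} (K : HeytingField c ℓ₁ ℓ₂) where
  open Cyclotomic K
  open HeytingField K using (#-irrefl; heytingCommutativeRing)
  private
    R = HeytingCommutativeRing.commutativeRing heytingCommutativeRing
  open CommutativeRing R
  open RingProperties ring
  open Mult semiring using (×-homo-+) renaming (_×_ to _·_)
  open SetoidReasoning setoid
  open Polynomial rawRing
  open PolynomialRing R

  fromℤ-⊖ : ∀ m n → fromℤ (m ⊖ n) ≈ m · 1# - n · 1#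
  fromℤ-⊖ zero    zero    = sym (-‿inverseʳ 0#)
  fromℤ-⊖ zero    (suc n) = sym (+-identityˡ _)
  fromℤ-⊖ (suc m) zero    = sym (trans (+-congˡ -0#≈0#) (+-identityʳ _))
  fromℤ-⊖ (suc m) (suc n) = begin
    fromℤ (suc m ⊖ suc n)                ≡⟨ ≡.cong fromℤ (ℤ.[1+m]⊖[1+n]≡m⊖n m n) ⟩
    fromℤ (m ⊖ n)                        ≈⟨ fromℤ-⊖ m n ⟩
    m · 1# - n · 1#                      ≈⟨ +-congʳ (xyx⁻¹≈y 1# _) ⟨
    1# + m · 1# - 1# - n · 1#            ≈⟨ +-assoc _ _ _ ⟩
    1# + m · 1# + (- 1# - n · 1#)        ≈⟨ +-congˡ (-‿+-comm _ _) ⟩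
    suc m · 1# - suc n · 1#              ∎

  fromℤ-+ : ∀ i j → fromℤ (i ℤ.+ j) ≈ fromℤ i + fromℤ j
  fromℤ-+ (+ m)    (+ n)    = ×-homo-+ 1# m n
  fromℤ-+ (+ m)    -[1+ n ] = fromℤ-⊖ m (suc n)
  fromℤ-+ -[1+ m ] (+ n)    = trans (fromℤ-⊖ n (suc m)) (+-comm _ _)
  fromℤ-+ -[1+ m ] -[1+ n ] = begin
    - (suc (suc (m ℕ.+ n)) · 1#)      ≡⟨ ≡.cong (λ k → - (suc k · 1#)) (ℕ.+-suc m n) ⟨
    - ((suc m ℕ.+ suc n) · 1#)        ≈⟨ -‿cong (×-homo-+ 1# (suc m) (suc n)) ⟩
    - (suc m · 1# + suc n · 1#)       ≈⟨ -‿+-comm _ _ ⟨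
    - (suc m · 1#) - suc n · 1#       ∎

  fromℤ-neg : ∀ i → fromℤ (ℤ.- i) ≈ - fromℤ i
  fromℤ-neg i = +-inverseˡ-unique _ _ (trans (sym (fromℤ-+ (ℤ.- i) i)) (reflexive (≡.cong fromℤ (ℤ.+-inverseˡ i))))

  fromℤ-* : ∀ i j → fromℤ (i ℤ.* j) ≈ fromℤ i * fromℤ j
  fromℤ-* (+ m)    j = fromℤ-*⁺ m j
    where
    fromℤ-*⁺ : ∀ m j → fromℤ (+ m ℤ.* j) ≈ m · 1# * fromℤ j
    fromℤ-*⁺ zero    j = sym (zeroˡ _)
    fromℤ-*⁺ (suc m) j = begin
      fromℤ (+ suc m ℤ.* j)                ≡⟨ ≡.cong fromℤ (ℤ.suc-* (+ m) j) ⟩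
      fromℤ (j ℤ.+ + m ℤ.* j)              ≈⟨ fromℤ-+ j _ ⟩
      fromℤ j + fromℤ (+ m ℤ.* j)          ≈⟨ +-cong (sym (*-identityˡ _)) (fromℤ-*⁺ m j) ⟩
      1# * fromℤ j + m · 1# * fromℤ j      ≈⟨ distribʳ _ _ _ ⟨
      suc m · 1# * fromℤ j                 ∎
  fromℤ-* -[1+ m ] j = begin
    fromℤ (ℤ.- (+ suc m) ℤ.* j)    ≡⟨ ≡.cong fromℤ (ℤ.neg-distribˡ-* (+ suc m) j) ⟨
    fromℤ (ℤ.- (+ suc m ℤ.* j))    ≈⟨ fromℤ-neg (+ suc m ℤ.* j) ⟩
    - fromℤ (+ suc m ℤ.* j)        ≈⟨ -‿cong (fromℤ-* (+ suc m) j) ⟩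
    - (suc m · 1# * fromℤ j)       ≈⟨ -‿distribˡ-* _ _ ⟩
    - (suc m · 1#) * fromℤ j       ∎

  fromℤ-injective : CharacteristicZero → ∀ i j → fromℤ i ≈ fromℤ j → i ≡ j
  fromℤ-injective char0 i j eq = ℤ.i-j≡0⇒i≡j i j (kernel (i ℤ.- j) (begin
    fromℤ (i ℤ.- j)         ≈⟨ fromℤ-+ i (ℤ.- j) ⟩
    fromℤ i + fromℤ (ℤ.- j) ≈⟨ +-cong eq (fromℤ-neg j) ⟩
    fromℤ j - fromℤ j       ≈⟨ -‿inverseʳ _ ⟩
    0#                      ∎))
    where
    kernel : ∀ i → fromℤ i ≈ 0# → i ≡ + 0
    kernel (+ zero)  _  = ≡.refl
    kernel (+ suc n) eq = contradiction (char0 n) (#-irrefl eq)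
    kernel -[1+ n ]  eq = contradiction (char0 n)
      (#-irrefl (-‿injective (trans eq (sym -0#≈0#))))

  mapℤ : ℤ[x].Poly → Poly
  mapℤ = map fromℤ

  ⟨⟩-mapℤ : ∀ f w → fromℤ ℤ[x].⟨ f , w ⟩ ≈ ⟨ mapℤ f , fromℤ ∘ w ⟩
  ⟨⟩-mapℤ []      w = refl
  ⟨⟩-mapℤ (a ∷ f) w = trans (fromℤ-+ (a ℤ.* w 0) _) (+-cong (fromℤ-* a _) (⟨⟩-mapℤ f _))

  fromℤ-δ : ∀ n i → fromℤ (ℤ[x].δ n i) ≈ δ n i
  fromℤ-δ zero    zero    = +-identityʳ 1#
  fromℤ-δ zero    (suc i) = refl
  fromℤ-δ (suc n) zero    = refl
  fromℤ-δ (suc n) (suc i) = fromℤ-δ n i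

  coeff-mapℤ : ∀ f n → coeff (mapℤ f) n ≈ fromℤ (ℤ[x].coeff f n)
  coeff-mapℤ []      n       = refl
  coeff-mapℤ (a ∷ f) zero    = refl
  coeff-mapℤ (a ∷ f) (suc n) = coeff-mapℤ f n

  coeff-mapℤ-⟨⟩ : ∀ f n → coeff (mapℤ f) n ≈ fromℤ ℤ[x].⟨ f , ℤ[x].δ n ⟩
  coeff-mapℤ-⟨⟩ f n = trans (coeff-mapℤ f n) (reflexive (≡.cong fromℤ (ℤ[x].coeff≈⟨⟩ f n)))

  mapℤ-cong : ∀ {f g} → f ℤ[x].≈ᵖ g → mapℤ f ≈ᵖ mapℤ g
  mapℤ-cong {f} {g} eq = ≋⇒≈ᵖ λ n → trans (coeff-mapℤ f n)
    (trans (reflexive (≡.cong fromℤ (ℤ[x].≈ᵖ⇒≋ eq n))) (sym (coeff-mapℤ g n)))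

  mapℤ-injective : CharacteristicZero → ∀ {f g} → mapℤ f ≈ᵖ mapℤ g → f ℤ[x].≋ g
  mapℤ-injective char0 {f} {g} eq n = fromℤ-injective char0 _ _
    (trans (sym (coeff-mapℤ f n)) (trans (≈ᵖ⇒≋ eq n) (coeff-mapℤ g n)))

  mapℤ-⊗ : ∀ f g → mapℤ (f ℤ[x].⊗ g) ≈ᵖ mapℤ f ⊗ mapℤ g
  mapℤ-⊗ f g = ≋⇒≈ᵖ λ n → begin
    coeff (mapℤ (f ℤ[x].⊗ g)) n ≈⟨ coeff-mapℤ-⟨⟩ (f ℤ[x].⊗ g) n ⟩
    _                           ≡⟨ ≡.cong fromℤ (ℤ[x].⟨⟩-⊗ f g (ℤ[x].δ n)) ⟩
    _                           ≈⟨ ⟨⟩-mapℤ f _ ⟩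
    _                           ≈⟨ ⟨⟩-congʳ (mapℤ f) (λ i → trans (⟨⟩-mapℤ g _)
                                     (⟨⟩-congʳ (mapℤ g) λ j → fromℤ-δ n (i ℕ.+ j))) ⟩
    _                           ≈⟨ ⟨⟩-⊗ (mapℤ f) (mapℤ g) (δ n) ⟨
    ⟨ mapℤ f ⊗ mapℤ g , δ n ⟩   ≈⟨ coeff≈⟨⟩ (mapℤ f ⊗ mapℤ g) n ⟨
    coeff (mapℤ f ⊗ mapℤ g) n   ∎

  mapℤ-unity : ∀ m → mapℤ (ℤ[x].unity m) ≈ᵖ unity m
  mapℤ-unity m = ≋⇒≈ᵖ λ n → begin
    coeff (mapℤ (ℤ[x].unity m)) n            ≈⟨ coeff-mapℤ-⟨⟩ (ℤ[x].unity m) n ⟩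
    fromℤ ℤ[x].⟨ ℤ[x].unity m , ℤ[x].δ n ⟩   ≡⟨ ≡.cong fromℤ (ℤ[x].⟨⟩-unity m (ℤ[x].δ n)) ⟩
    fromℤ (ℤ[x].δ n m ℤ.- ℤ[x].δ n 0)        ≈⟨ fromℤ-+ (ℤ[x].δ n m) _ ⟩
    _                                        ≈⟨ +-cong (fromℤ-δ n m) (trans (fromℤ-neg (ℤ[x].δ n 0)) (-‿cong (fromℤ-δ n 0))) ⟩
    δ n m - δ n 0                            ≈⟨ ⟨⟩-unity m (δ n) ⟨
    ⟨ unity m , δ n ⟩                        ≈⟨ coeff≈⟨⟩ (unity m) n ⟨
    coeff (unity m) n                        ∎

-- Uniqueness of Ψₙ and a criterion for Ψ_pqr.

module InverseCyclotomic {c ℓ₁ ℓ₂} (K : HeytingField c ℓ₁ ℓ₂) where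
  open Cyclotomic K
  private
    R = HeytingCommutativeRing.commutativeRing (HeytingField.heytingCommutativeRing K)
  open Polynomial (CommutativeRing.rawRing R)
  open PolynomialRing R
  open CyclotomicFactorisation K
  open IntegerPolynomials K
  private module P = CommutativeRing polynomialRing
  open SetoidReasoning P.setoid

  -- Instead of cancelling Φ, compute Ψ′ Φ Ψ in two ways: this gives (xⁿ - 1) Ψ = (xⁿ - 1) Ψ′, where
  -- xⁿ - 1 can be cancelled.
  inverseCyclotomic-unique : CharacteristicZero → ∀ n .{{_ : NonZero n}} ζ Ψ Ψ′ →
    IsInverseCyclotomic n ζ Ψ → IsInverseCyclotomic n ζ Ψ′ → Ψ ℤ[x].≋ Ψ′
  inverseCyclotomic-unique char0 n ζ Ψ Ψ′ inv inv′ = mapℤ-injective char0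
    (unity-cancel n (mapℤ Ψ) (mapℤ Ψ′) (begin
      unity n ⊗ mapℤ Ψ            ≈⟨ ⊗-cong (quotient Ψ′ inv′) (P.refl {mapℤ Ψ}) ⟨
      mapℤ Ψ′ ⊗ Φ n ζ ⊗ mapℤ Ψ    ≈⟨ ⊗-assoc (mapℤ Ψ′) (Φ n ζ) (mapℤ Ψ) ⟩
      mapℤ Ψ′ ⊗ (Φ n ζ ⊗ mapℤ Ψ)  ≈⟨ ⊗-comm (mapℤ Ψ′) _ ⟩
      Φ n ζ ⊗ mapℤ Ψ ⊗ mapℤ Ψ′    ≈⟨ ⊗-cong (⊗-comm (Φ n ζ) (mapℤ Ψ)) (P.refl {mapℤ Ψ′}) ⟩
      mapℤ Ψ ⊗ Φ n ζ ⊗ mapℤ Ψ′    ≈⟨ ⊗-cong (quotient Ψ inv) (P.refl {mapℤ Ψ′}) ⟩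
      unity n ⊗ mapℤ Ψ′           ∎))
    where
    quotient : ∀ Ψ → IsInverseCyclotomic n ζ Ψ → mapℤ Ψ ⊗ Φ n ζ ≈ᵖ unity n
    quotient Ψ = ≋⇒≈ᵖ

  ⊗-4 : ∀ {a b c d e f g h} → a ≈ᵖ e → b ≈ᵖ f → c ≈ᵖ g → d ≈ᵖ h →
    a ⊗ (b ⊗ (c ⊗ d)) ≈ᵖ e ⊗ (f ⊗ (g ⊗ h))
  ⊗-4 p q r s = ⊗-cong p (⊗-cong q (⊗-cong r s))

  -- The Möbius formula reads Φ U = (xⁿ - 1) V, and the hypothesis is Ψ V = U over ℤ. Together they
  -- give U (Ψ Φ) = U (xⁿ - 1), and the four factors of U are cancelled one at a time.
  inverseCyclotomic-pqr : ∀ {p q r} → Prime p → Prime q → Prime r →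
    Coprime p q → Coprime p r → Coprime q r →
    .{{_ : NonZero p}} .{{_ : NonZero q}} .{{_ : NonZero r}} →
    ∀ {ζ} → IsPrimitiveRoot (p ℕ.* q ℕ.* r) ζ → ∀ Ψ →
    Ψ ℤ[x].⊗ (ℤ[x].unity p ℤ[x].⊗ (ℤ[x].unity q ℤ[x].⊗ ℤ[x].unity r)) ℤ[x].≈ᵖ
      ℤ[x].unity (p ℕ.* q) ℤ[x].⊗ (ℤ[x].unity (p ℕ.* r) ℤ[x].⊗
        (ℤ[x].unity (q ℕ.* r) ℤ[x].⊗ ℤ[x].unity 1)) →
    IsInverseCyclotomic (p ℕ.* q ℕ.* r) ζ Ψ
  inverseCyclotomic-pqr {p} {q} {r} p-prime q-prime r-prime p⊥q p⊥r q⊥r {ζ} prim Ψ eq = ≈ᵖ⇒≋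
    (unity-cancel 1 _ _ (peel (q ℕ.* r) (unity 1) _ _ (peel (p ℕ.* r) _ _ _ (peel (p ℕ.* q) _ _ _ main))))
    where
    n = p ℕ.* q ℕ.* r

    instance
      pq≢0 : NonZero (p ℕ.* q)
      pq≢0 = ℕ.m*n≢0 p q
      pr≢0 : NonZero (p ℕ.* r)
      pr≢0 = ℕ.m*n≢0 p r
      qr≢0 : NonZero (q ℕ.* r)
      qr≢0 = ℕ.m*n≢0 q r

    peel : ∀ m .{{_ : NonZero m}} u f g → (unity m ⊗ u) ⊗ f ≈ᵖ (unity m ⊗ u) ⊗ g → u ⊗ f ≈ᵖ u ⊗ g
    peel m u f g eq = unity-cancel m (u ⊗ f) (u ⊗ g)
      (P.trans (P.sym (⊗-assoc (unity m) u f)) (P.trans eq (⊗-assoc (unity m) u g)))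

    U V : Poly
    U = unity (p ℕ.* q) ⊗ (unity (p ℕ.* r) ⊗ (unity (q ℕ.* r) ⊗ unity 1))
    V = unity p ⊗ (unity q ⊗ unity r)

    mapped : mapℤ Ψ ⊗ V ≈ᵖ U
    mapped = begin
      mapℤ Ψ ⊗ (unity p ⊗ (unity q ⊗ unity r))
        ≈⟨ ⊗-4 (P.refl {mapℤ Ψ}) (mapℤ-unity p) (mapℤ-unity q) (mapℤ-unity r) ⟨
      mapℤ Ψ ⊗ (mapℤ (ℤ[x].unity p) ⊗ (mapℤ (ℤ[x].unity q) ⊗ mapℤ (ℤ[x].unity r)))
        ≈⟨ mapℤ-⊗₄ Ψ (ℤ[x].unity p) (ℤ[x].unity q) (ℤ[x].unity r) ⟨
      _ ≈⟨ mapℤ-cong eq ⟩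
      _ ≈⟨ mapℤ-⊗₄ (ℤ[x].unity (p ℕ.* q)) (ℤ[x].unity (p ℕ.* r)) (ℤ[x].unity (q ℕ.* r)) (ℤ[x].unity 1) ⟩
      mapℤ (ℤ[x].unity (p ℕ.* q)) ⊗ (mapℤ (ℤ[x].unity (p ℕ.* r)) ⊗ (mapℤ (ℤ[x].unity (q ℕ.* r)) ⊗ mapℤ (ℤ[x].unity 1)))
        ≈⟨ ⊗-4 (mapℤ-unity (p ℕ.* q)) (mapℤ-unity (p ℕ.* r)) (mapℤ-unity (q ℕ.* r)) (mapℤ-unity 1) ⟩
      U ∎
      where
      mapℤ-⊗₄ : ∀ a b c d → mapℤ (a ℤ[x].⊗ (b ℤ[x].⊗ (c ℤ[x].⊗ d))) ≈ᵖ mapℤ a ⊗ (mapℤ b ⊗ (mapℤ c ⊗ mapℤ d))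
      mapℤ-⊗₄ a b c d = P.trans (mapℤ-⊗ a (b ℤ[x].⊗ (c ℤ[x].⊗ d))) (⊗-cong (P.refl {mapℤ a})
        (P.trans (mapℤ-⊗ b (c ℤ[x].⊗ d)) (⊗-cong (P.refl {mapℤ b}) (mapℤ-⊗ c d))))

    main : U ⊗ (mapℤ Ψ ⊗ Φ n ζ) ≈ᵖ U ⊗ unity n
    main = begin
      U ⊗ (mapℤ Ψ ⊗ Φ n ζ)      ≈⟨ ⊗-comm U _ ⟩
      mapℤ Ψ ⊗ Φ n ζ ⊗ U        ≈⟨ ⊗-assoc (mapℤ Ψ) (Φ n ζ) U ⟩
      mapℤ Ψ ⊗ (Φ n ζ ⊗ U)      ≈⟨ ⊗-cong (P.refl {mapℤ Ψ}) (Φ-pqr p-prime q-prime r-prime p⊥q p⊥r q⊥r prim) ⟩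
      mapℤ Ψ ⊗ (unity n ⊗ V)    ≈⟨ ⊗-cong (P.refl {mapℤ Ψ}) (⊗-comm (unity n) V) ⟩
      mapℤ Ψ ⊗ (V ⊗ unity n)    ≈⟨ ⊗-assoc (mapℤ Ψ) V (unity n) ⟨
      mapℤ Ψ ⊗ V ⊗ unity n      ≈⟨ ⊗-cong mapped (P.refl {unity n}) ⟩
      U ⊗ unity n               ∎

-- The integer polynomials Φ_pq and Ψ_pqr in explicit form.

-- a p + b q = p q + 1 with a < q and b < p, so that a and b are the inverses of
-- p and q; c = q − a and d = p − b.
module LamLeung (p q a b c d : ℕ) (a+c≡q : a ℕ.+ c ≡ q) (b+d≡p : b ℕ.+ d ≡ p)
                (bezout : a ℕ.* p ℕ.+ b ℕ.* q ≡ p ℕ.* q ℕ.+ 1) where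
  open ℤ[x]
  open Range ℤ.+-0-commutativeMonoid using () renaming (fold< to ∑<; fold<-cong to ∑<-cong)
  private module P = CommutativeRing polynomialRing

  -- The formula of Lam and Leung serves as the definition; `Φpq-spec` justifies it. Their second
  -- sum has indices from a to q - 1 and from b to p - 1 and is divided by x^(pq). Moving the
  -- indices to start at 0 leaves the factor x^(ap + bq - pq) = x.
  Φpq : Poly
  Φpq = geometric p a ⊗ geometric q b P.- X^ 1 ⊗ (geometric p c ⊗ geometric q d)

  1+cp≡bq : 1 ℕ.+ c ℕ.* p ≡ b ℕ.* q
  1+cp≡bq = ℕ.+-cancelˡ-≡ (a ℕ.* p) _ _ (begin
    a ℕ.* p ℕ.+ (1 ℕ.+ c ℕ.* p) ≡⟨ rearrange a c p ⟩
    p ℕ.* (a ℕ.+ c) ℕ.+ 1       ≡⟨ ≡.cong (λ x → p ℕ.* x ℕ.+ 1) a+c≡q ⟩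
    p ℕ.* q ℕ.+ 1               ≡⟨ bezout ⟨
    a ℕ.* p ℕ.+ b ℕ.* q         ∎)
    where
    open ≡-Reasoning
    rearrange : ∀ a c p → a ℕ.* p ℕ.+ (1 ℕ.+ c ℕ.* p) ≡ p ℕ.* (a ℕ.+ c) ℕ.+ 1
    rearrange = ℕ-Solver.solve-∀

  1+dq≡ap : 1 ℕ.+ d ℕ.* q ≡ a ℕ.* p
  1+dq≡ap = ℕ.+-cancelˡ-≡ (b ℕ.* q) _ _ (begin
    b ℕ.* q ℕ.+ (1 ℕ.+ d ℕ.* q) ≡⟨ rearrange b d q ⟩
    (b ℕ.+ d) ℕ.* q ℕ.+ 1       ≡⟨ ≡.cong (λ x → x ℕ.* q ℕ.+ 1) b+d≡p ⟩
    p ℕ.* q ℕ.+ 1               ≡⟨ bezout ⟨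
    a ℕ.* p ℕ.+ b ℕ.* q         ≡⟨ ℕ.+-comm (a ℕ.* p) (b ℕ.* q) ⟩
    b ℕ.* q ℕ.+ a ℕ.* p         ∎)
    where
    open ≡-Reasoning
    rearrange : ∀ b d q → b ℕ.* q ℕ.+ (1 ℕ.+ d ℕ.* q) ≡ (b ℕ.+ d) ℕ.* q ℕ.+ 1
    rearrange = ℕ-Solver.solve-∀

  1+cp+dq≡pq : 1 ℕ.+ (c ℕ.* p ℕ.+ d ℕ.* q) ≡ p ℕ.* q
  1+cp+dq≡pq = begin
    1 ℕ.+ c ℕ.* p ℕ.+ d ℕ.* q   ≡⟨ ≡.cong (ℕ._+ d ℕ.* q) 1+cp≡bq ⟩
    b ℕ.* q ℕ.+ d ℕ.* q         ≡⟨ ℕ.*-distribʳ-+ q b d ⟨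
    (b ℕ.+ d) ℕ.* q             ≡⟨ ≡.cong (ℕ._* q) b+d≡p ⟩
    p ℕ.* q                     ∎
    where open ≡-Reasoning

  ⟨⟩-unity⊗unity : ∀ m n w → ⟨ unity m ⊗ unity n , w ⟩ ≡ (w (m ℕ.+ n) ℤ.- w m) ℤ.- (w n ℤ.- w 0)
  ⟨⟩-unity⊗unity m n w = begin
    ⟨ unity m ⊗ unity n , w ⟩ ≡⟨ ⟨⟩-unity⊗ m (unity n) w ⟩
    ⟨ unity n , w ∘ (m ℕ.+_) ⟩ ℤ.- ⟨ unity n , w ⟩
      ≡⟨ ≡.cong₂ ℤ._-_ (⟨⟩-unity n (w ∘ (m ℕ.+_))) (⟨⟩-unity n w) ⟩
    (w (m ℕ.+ n) ℤ.- w (m ℕ.+ 0)) ℤ.- (w n ℤ.- w 0)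
      ≡⟨ ≡.cong (λ k → (w (m ℕ.+ n) ℤ.- w k) ℤ.- (w n ℤ.- w 0)) (ℕ.+-identityʳ m) ⟩
    (w (m ℕ.+ n) ℤ.- w m) ℤ.- (w n ℤ.- w 0) ∎
    where open ≡-Reasoning

  -- Expansion of the left side gives eight monomials. Since 1 + c p = b q and 1 + d q = a p, two
  -- pairs cancel; the exponents p q + 1, p q, 1 and 0 remain.
  unity-identity : unity (a ℕ.* p) ⊗ unity (b ℕ.* q) P.- X^ 1 ⊗ (unity (c ℕ.* p) ⊗ unity (d ℕ.* q)) ≈ᵖ
                   unity (p ℕ.* q) ⊗ unity 1
  unity-identity = pairwise λ w → begin
    ⟨ unity (a ℕ.* p) ⊗ unity (b ℕ.* q) P.- X^ 1 ⊗ Z , w ⟩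
      ≡⟨ ⟨⟩-⊝ (unity (a ℕ.* p) ⊗ unity (b ℕ.* q)) (X^ 1 ⊗ Z) w ⟩
    _ ≡⟨ ≡.cong₂ ℤ._-_ (⟨⟩-unity⊗unity (a ℕ.* p) (b ℕ.* q) w)
           (≡.trans (⟨⟩-X^⊗ 1 Z w) (⟨⟩-unity⊗unity (c ℕ.* p) (d ℕ.* q) (w ∘ suc))) ⟩
    ((w (a ℕ.* p ℕ.+ b ℕ.* q) ℤ.- w (a ℕ.* p)) ℤ.- (w (b ℕ.* q) ℤ.- w 0)) ℤ.-
      ((w (1 ℕ.+ (c ℕ.* p ℕ.+ d ℕ.* q)) ℤ.- w (1 ℕ.+ c ℕ.* p)) ℤ.- (w (1 ℕ.+ d ℕ.* q) ℤ.- w 1))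
      ≡⟨ substitute w bezout 1+cp+dq≡pq 1+cp≡bq 1+dq≡ap ⟩
    ((w (p ℕ.* q ℕ.+ 1) ℤ.- w (a ℕ.* p)) ℤ.- (w (b ℕ.* q) ℤ.- w 0)) ℤ.-
      ((w (p ℕ.* q) ℤ.- w (b ℕ.* q)) ℤ.- (w (a ℕ.* p) ℤ.- w 1))
      ≡⟨ cancel (w (p ℕ.* q ℕ.+ 1)) (w (a ℕ.* p)) (w (b ℕ.* q)) (w 0) (w (p ℕ.* q)) (w 1) ⟩
    (w (p ℕ.* q ℕ.+ 1) ℤ.- w (p ℕ.* q)) ℤ.- (w 1 ℤ.- w 0)
      ≡⟨ ⟨⟩-unity⊗unity (p ℕ.* q) 1 w ⟨
    ⟨ unity (p ℕ.* q) ⊗ unity 1 , w ⟩ ∎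
    where
    open ≡-Reasoning
    Z = unity (c ℕ.* p) ⊗ unity (d ℕ.* q)

    substitute : ∀ (w : ℕ → ℤ) {i i′ j j′ k k′ l l′} {x y z} → i ≡ i′ → j ≡ j′ → k ≡ k′ → l ≡ l′ →
      ((w i ℤ.- x) ℤ.- y) ℤ.- ((w j ℤ.- w k) ℤ.- (w l ℤ.- z)) ≡
      ((w i′ ℤ.- x) ℤ.- y) ℤ.- ((w j′ ℤ.- w k′) ℤ.- (w l′ ℤ.- z))
    substitute w ≡.refl ≡.refl ≡.refl ≡.refl = ≡.refl

    cancel : ∀ s t u v x y → ((s ℤ.- t) ℤ.- (u ℤ.- v)) ℤ.- ((x ℤ.- u) ℤ.- (t ℤ.- y)) ≡ (s ℤ.- x) ℤ.- (y ℤ.- v)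
    cancel = ℤ-Solver.solve-∀

  Φpq-spec : (unity p ⊗ unity q) ⊗ Φpq ≈ᵖ unity (p ℕ.* q) ⊗ unity 1
  Φpq-spec = begin
    U ⊗ (G P.- X^ 1 ⊗ H)               ≈⟨ x[y-z]≈xy-xz U G (X^ 1 ⊗ H) ⟩
    U ⊗ G P.- U ⊗ (X^ 1 ⊗ H)
      ≈⟨ P.+-cong {x = U ⊗ G} {y = G′} (pairs a b)
           (P.-‿cong (P.trans (x∙yz≈y∙xz U (X^ 1) H) (⊗-cong (P.refl {X^ 1}) (pairs c d)))) ⟩
    G′ P.- X^ 1 ⊗ (unity (c ℕ.* p) ⊗ unity (d ℕ.* q)) ≈⟨ unity-identity ⟩
    unity (p ℕ.* q) ⊗ unity 1                         ∎
    where
    open SetoidReasoning P.setoid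
    open RingProperties P.ring using (x[y-z]≈xy-xz)
    open CommutativeSemigroupProperties
      (CommutativeMonoid.commutativeSemigroup P.*-commutativeMonoid) using (x∙yz≈y∙xz; interchange)
    U G H G′ : Poly
    U = unity p ⊗ unity q
    G = geometric p a ⊗ geometric q b
    H = geometric p c ⊗ geometric q d
    G′ = unity (a ℕ.* p) ⊗ unity (b ℕ.* q)

    pairs : ∀ m n → (unity p ⊗ unity q) ⊗ (geometric p m ⊗ geometric q n) ≈ᵖ unity (m ℕ.* p) ⊗ unity (n ℕ.* q)
    pairs m n = P.trans (interchange (unity p) (unity q) (geometric p m) (geometric q n))
      (⊗-cong (unity⊗geometric p m) (unity⊗geometric q n))

  box : ℕ → ℕ → (ℕ → ℤ) → ℤ
  box m n w = ∑< m (λ x → ∑< n (λ y → w (x ℕ.* p ℕ.+ y ℕ.* q)))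

  ⟨⟩-Φpq : ∀ w → ⟨ Φpq , w ⟩ ≡ box a b w ℤ.- box c d (w ∘ suc)
  ⟨⟩-Φpq w = ≡.trans (⟨⟩-⊝ (geometric p a ⊗ geometric q b) (X^ 1 ⊗ H) w)
    (≡.cong₂ ℤ._-_ (⟨⟩-box a b w) (≡.trans (⟨⟩-X^⊗ 1 H w) (⟨⟩-box c d (w ∘ suc))))
    where
    H = geometric p c ⊗ geometric q d
    ⟨⟩-box : ∀ m n w → ⟨ geometric p m ⊗ geometric q n , w ⟩ ≡ box m n w
    ⟨⟩-box m n w = ≡.trans (⟨⟩-⊗ (geometric p m) (geometric q n) w)
      (≡.trans (⟨⟩-geometric p m λ i → ⟨ geometric q n , (λ j → w (i ℕ.+ j)) ⟩)
               (∑<-cong m λ x → ⟨⟩-geometric q n λ j → w (x ℕ.* p ℕ.+ j)))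

  Ψpqr : ℕ → Poly
  Ψpqr r = unity (q ℕ.* r) ⊗ (geometric r p ⊗ Φpq)

  Ψpqr-spec : ∀ r → Ψpqr r ⊗ (unity p ⊗ (unity q ⊗ unity r)) ≈ᵖ
    unity (p ℕ.* q) ⊗ (unity (p ℕ.* r) ⊗ (unity (q ℕ.* r) ⊗ unity 1))
  Ψpqr-spec r = begin
    unity (q ℕ.* r) ⊗ (geometric r p ⊗ Φpq) ⊗ (unity p ⊗ (unity q ⊗ unity r))
      ≈⟨ prove 6 ((v₀ :∙ (v₁ :∙ v₂)) :∙ (v₃ :∙ (v₄ :∙ v₅))) (((v₃ :∙ v₄) :∙ v₂) :∙ ((v₅ :∙ v₁) :∙ v₀))
           (unity (q ℕ.* r) Vec.∷ geometric r p Vec.∷ Φpq Vec.∷ unity p Vec.∷ unity q Vec.∷ unity r Vec.∷ Vec.[]) ⟩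
    unity p ⊗ unity q ⊗ Φpq ⊗ (unity r ⊗ geometric r p ⊗ unity (q ℕ.* r))
      ≈⟨ ⊗-cong Φpq-spec (⊗-cong (unity⊗geometric r p) (P.refl {unity (q ℕ.* r)})) ⟩
    unity (p ℕ.* q) ⊗ unity 1 ⊗ (unity (p ℕ.* r) ⊗ unity (q ℕ.* r))
      ≈⟨ prove 4 ((v₀ :∙ v₁) :∙ (v₂ :∙ v₃)) (v₀ :∙ (v₂ :∙ (v₃ :∙ v₁)))
           (unity (p ℕ.* q) Vec.∷ unity 1 Vec.∷ unity (p ℕ.* r) Vec.∷ unity (q ℕ.* r) Vec.∷ Vec.[]) ⟩
    unity (p ℕ.* q) ⊗ (unity (p ℕ.* r) ⊗ (unity (q ℕ.* r) ⊗ unity 1)) ∎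
    where
    open SetoidReasoning P.setoid
    open CommutativeMonoidSolver P.*-commutativeMonoid using (Expr; prove; var) renaming (_⊕_ to _:∙_)
    v₀ v₁ v₂ v₃ : ∀ {n} → Expr (4 ℕ.+ n)
    v₀ = var 0F
    v₁ = var 1F
    v₂ = var 2F
    v₃ = var 3F
    v₄ v₅ : Expr 6
    v₄ = var 4F
    v₅ = var 5F

  -- The factor x^(qr) - 1 produces the two blocks of p shifts by multiples of r, one beginning at q
  -- r and the other, subtracted, at 0.
  ⟨⟩-Ψpqr : ∀ r w → ⟨ Ψpqr r , w ⟩ ≡
    ∑< p (λ j → ⟨ Φpq , (λ i → w ((q ℕ.+ j) ℕ.* r ℕ.+ i)) ⟩) ℤ.-
    ∑< p (λ j → ⟨ Φpq , (λ i → w (j ℕ.* r ℕ.+ i)) ⟩)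
  ⟨⟩-Ψpqr r w = begin
    ⟨ Ψpqr r , w ⟩ ≡⟨ ⟨⟩-unity⊗ (q ℕ.* r) (geometric r p ⊗ Φpq) w ⟩
    ⟨ geometric r p ⊗ Φpq , w ∘ (q ℕ.* r ℕ.+_) ⟩ ℤ.- ⟨ geometric r p ⊗ Φpq , w ⟩
      ≡⟨ ≡.cong₂ ℤ._-_ (expand (w ∘ (q ℕ.* r ℕ.+_))) (expand w) ⟩
    ∑< p (λ j → ⟨ Φpq , (λ i → w (q ℕ.* r ℕ.+ (j ℕ.* r ℕ.+ i))) ⟩) ℤ.-
      ∑< p (λ j → ⟨ Φpq , (λ i → w (j ℕ.* r ℕ.+ i)) ⟩)
      ≡⟨ ≡.cong (λ s → s ℤ.- ∑< p (λ j → ⟨ Φpq , (λ i → w (j ℕ.* r ℕ.+ i)) ⟩))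
           (∑<-cong p λ j → ⟨⟩-congʳ Φpq λ i → ≡.cong w (shift j i)) ⟩
    ∑< p (λ j → ⟨ Φpq , (λ i → w ((q ℕ.+ j) ℕ.* r ℕ.+ i)) ⟩) ℤ.-
      ∑< p (λ j → ⟨ Φpq , (λ i → w (j ℕ.* r ℕ.+ i)) ⟩) ∎
    where
    open ≡-Reasoning
    expand : ∀ w → ⟨ geometric r p ⊗ Φpq , w ⟩ ≡ ∑< p (λ j → ⟨ Φpq , (λ i → w (j ℕ.* r ℕ.+ i)) ⟩)
    expand w = ≡.trans (⟨⟩-⊗ (geometric r p) Φpq w)
      (⟨⟩-geometric r p λ i → ⟨ Φpq , (λ j → w (i ℕ.+ j)) ⟩)

    shift : ∀ j i → q ℕ.* r ℕ.+ (j ℕ.* r ℕ.+ i) ≡ (q ℕ.+ j) ℕ.* r ℕ.+ i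
    shift j i = ≡.trans (≡.sym (ℕ.+-assoc (q ℕ.* r) (j ℕ.* r) i)) (≡.cong (ℕ._+ i) (≡.sym (ℕ.*-distribʳ-+ r q j)))

-- Representations x p + y q along progressions of difference r.

module RepresentationCounts where
  open import Data.Empty using (⊥)
  open import Data.Nat.Base
  open import Data.Nat.Divisibility
  open import Data.Nat.Properties
  open ≡ using (refl; sym; trans; cong; subst)

  open Range +-0-commutativeMonoid using () renaming (fold< to ∑; fold<-ε to ∑-zero; fold<-+ to ∑-+)

  ∑-positive : ∀ n f → 0 < ∑ n f → ∃[ i ] i < n × 0 < f i
  ∑-positive (suc n) f 0<∑ with f 0 in eq
  ... | suc _ = 0 , z<s , subst (0 <_) (sym eq) z<s
  ... | zero  = let (i , i<n , 0<fi) = ∑-positive n (f ∘ suc) 0<∑ in suc i , s<s i<n , 0<fi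

  term≤∑ : ∀ n f {i} → i < n → f i ≤ ∑ n f
  term≤∑ (suc n) f {zero}  _   = m≤m+n (f 0) _
  term≤∑ (suc n) f {suc i} i<n = ≤-trans (term≤∑ n (f ∘ suc) (s<s⁻¹ i<n)) (m≤n+m _ (f 0))

  ∑-≥ : ∀ {m n f} → m ≤ n → (∀ i → i < m → 0 < f i) → m ≤ ∑ n f
  ∑-≥ {zero}  _         _   = z≤n
  ∑-≥ {suc m} (s≤s m≤n) 0<f = +-mono-≤ (0<f 0 z<s) (∑-≥ m≤n λ i i<m → 0<f (suc i) (s<s i<m))

  ∑-support : ∀ n K f → (∀ i → f i ≤ 1) → (∀ i → i < n → 0 < f i → i < K) → ∑ n f ≤ K
  ∑-support zero    K       f f≤1 supp = z≤n
  ∑-support (suc n) zero    f f≤1 supp =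
    ≤-reflexive (∑-zero (suc n) λ i i<n → n≤0⇒n≡0 (≮⇒≥ λ 0<fi → contradiction (supp i i<n 0<fi) λ ()))
  ∑-support (suc n) (suc K) f f≤1 supp =
    +-mono-≤ (f≤1 0) (∑-support n K (f ∘ suc) (f≤1 ∘ suc) λ i i<n 0<fi → s<s⁻¹ (supp (suc i) (s<s i<n) 0<fi))

  -- Counted from the first positive term, all positive terms lie in a window of K positions, each
  -- contributing at most 1.
  ∑-spread : ∀ n K f → (∀ i → f i ≤ 1) →
    (∀ i k → i + k < n → 0 < f i → 0 < f (i + k) → k < K) → ∑ n f ≤ K
  ∑-spread zero    K f f≤1 gap = z≤n
  ∑-spread (suc n) K f f≤1 gap with f 0 in eq
  ... | zero  = ∑-spread n K (f ∘ suc) (f≤1 ∘ suc) λ i k i+k<n → gap (suc i) k (s<s i+k<n)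
  ... | suc _ = subst (λ f₀ → f₀ + ∑ n (f ∘ suc) ≤ K) eq
    (∑-support (suc n) K f f≤1 λ i i<n → gap 0 i i<n (subst (0 <_) (sym eq) z<s))

  -- The Kronecker delta again, now in ℕ, where a positive sum has a positive term and counts can be
  -- compared.
  indicator : ℕ → ℕ → ℕ
  indicator zero    zero    = 1
  indicator zero    (suc k) = 0
  indicator (suc n) zero    = 0
  indicator (suc n) (suc k) = indicator n k

  indicator≤1 : ∀ n k → indicator n k ≤ 1
  indicator≤1 zero    zero    = ≤-refl
  indicator≤1 zero    (suc k) = z≤n
  indicator≤1 (suc n) zero    = z≤n
  indicator≤1 (suc n) (suc k) = indicator≤1 n k

  indicator-positive : ∀ n k → 0 < indicator n k → n ≡ k
  indicator-positive zero    zero    _   = refl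
  indicator-positive (suc n) (suc k) 0<1 = cong suc (indicator-positive n k 0<1)

  indicator-refl : ∀ {n k} → n ≡ k → 0 < indicator n k
  indicator-refl {zero}  refl = z<s
  indicator-refl {suc n} refl = indicator-refl {n} refl

  module _ {p q : ℕ} .{{_ : NonZero p}} .{{_ : NonZero q}} (p⊥q : Coprime p q) where

    -- The equation makes (X - x) p a multiple of q, hence X - x as well, by coprimality.
    combination-jump : ∀ X Y x y → X * p + Y * q ≡ x * p + y * q → x < X → x + q ≤ X
    combination-jump X Y x y eq x<X with m<n⇒∃[o]m+o≡n x<X
      where
      m<n⇒∃[o]m+o≡n : ∀ {m n} → m < n → ∃[ o ] m + suc o ≡ n
      m<n⇒∃[o]m+o≡n {m} m<n = let (o , eq) = m≤n⇒∃[o]m+o≡n m<n in o , trans (+-suc m o) eq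
    ... | (e , refl) = +-monoʳ-≤ x (∣⇒≤ (coprime-divisor (Coprimality.sym p⊥q)
            (subst (q ∣_) (*-comm (suc e) p)
              (∣m+n∣m⇒∣n (divides y (+-cancelˡ-≡ (x * p) _ _ (trans (rearrange x (suc e) Y p q) eq)))
                (n∣m*n Y)))))
      where
      rearrange : ∀ x e Y p q → x * p + (Y * q + e * p) ≡ (x + e) * p + Y * q
      rearrange = ℕ-Solver.solve-∀

    combination-≥ : ∀ X Y x y → X * p + Y * q ≡ x * p + y * q → x < q → x ≤ X
    combination-≥ X Y x y eq x<q = ≮⇒≥ λ X<x →
      <⇒≱ x<q (≤-trans (m≤n+m q X) (combination-jump x y X Y (sym eq) X<x))

  -- Only x and y have to be small, since X and Y will be coordinates moved by an unknown number of
  -- steps. Smallness gives x ≤ X and y ≤ Y, and the equality of the sums leaves no slack.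
  combination-unique : ∀ {p q} .{{_ : NonZero p}} .{{_ : NonZero q}} → Coprime p q →
    ∀ X Y x y → X * p + Y * q ≡ x * p + y * q → x < q → y < p → X ≡ x × Y ≡ y
  combination-unique {p} {q} p⊥q X Y x y eq x<q y<p =
    ≤-antisym (*-cancelʳ-≤ X x p (+-cancelʳ-≤ (y * q) _ _
                (≤-trans (+-monoʳ-≤ (X * p) (*-monoˡ-≤ q y≤Y)) (≤-reflexive eq)))) x≤X ,
    ≤-antisym (*-cancelʳ-≤ Y y q (+-cancelˡ-≤ (x * p) _ _
                (≤-trans (+-monoˡ-≤ (Y * q) (*-monoˡ-≤ p x≤X)) (≤-reflexive eq)))) y≤Y
    where
    x≤X : x ≤ X
    x≤X = combination-≥ p⊥q X Y x y eq x<q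
    y≤Y : y ≤ Y
    y≤Y = combination-≥ (Coprimality.sym p⊥q) Y X y x
      (trans (+-comm (Y * q) (X * p)) (trans eq (+-comm (x * p) (y * q)))) y<p

  -- For n > 0 the ceiling of m/n is the number of k ≥ 0 with k n < m. The first half will bound the
  -- length of a run, the second will show that a run of this length fits.
  IsCeiling : ℕ → ℕ → ℕ → Set
  IsCeiling m n A = (∀ k → k * n < m → k < A) × (∀ k → k < A → k * n < m)

  module Chains (p q r α β : ℕ) .{{_ : NonZero p}} .{{_ : NonZero q}} (p⊥q : Coprime p q)
                (r≡ : r ≡ α * p + β * q) where

    -- The offset `e` is 0 for the positive and 1 for the negative terms of Φ_pq; `i` will be a
    -- multiple j r.
    box : ℕ → ℕ → ℕ → ℕ → ℕ → ℕ
    box n e m l i = ∑ m λ x → ∑ l λ y → indicator n (i + (e + (x * p + y * q)))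

    box-positive : ∀ n e m l i → 0 < box n e m l i →
      ∃₂ λ x y → x < m × y < l × n ≡ i + (e + (x * p + y * q))
    box-positive n e m l i 0<box =
      let (x , x<m , 0<row) = ∑-positive m _ 0<box
          (y , y<l , 0<ind) = ∑-positive l _ 0<row
      in x , y , x<m , y<l , indicator-positive n _ 0<ind

    box-member : ∀ n e m l i x y → x < m → y < l → n ≡ i + (e + (x * p + y * q)) → 0 < box n e m l i
    box-member n e m l i x y x<m y<l eq = <-≤-trans (indicator-refl eq)
      (≤-trans (term≤∑ l (λ y → indicator n (i + (e + (x * p + y * q)))) y<l)
               (term≤∑ m (λ x → ∑ l λ y → indicator n (i + (e + (x * p + y * q)))) x<m))

    step : ∀ k x y → k * r + (x * p + y * q) ≡ (x + k * α) * p + (y + k * β) * q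
    step k x y rewrite r≡ = rearrange k α β p q x y
      where
      rearrange : ∀ k α β p q x y →
        k * (α * p + β * q) + (x * p + y * q) ≡ (x + k * α) * p + (y + k * β) * q
      rearrange = ℕ-Solver.solve-∀

    chain-step : ∀ n j k e e′ s x y → n ≡ j * r + (e + s) → n ≡ (j + k) * r + (e′ + (x * p + y * q)) →
      e + s ≡ e′ + ((x + k * α) * p + (y + k * β) * q)
    chain-step n j k e e′ s x y eq eq′ = +-cancelˡ-≡ (j * r) _ _ (begin
      j * r + (e + s)                            ≡⟨ trans (sym eq) eq′ ⟩
      (j + k) * r + (e′ + (x * p + y * q))       ≡⟨ rearrange j k r e′ (x * p + y * q) ⟩
      j * r + (e′ + (k * r + (x * p + y * q)))   ≡⟨ cong (λ t → j * r + (e′ + t)) (step k x y) ⟩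
      _                                          ∎)
      where
      open ≡-Reasoning
      rearrange : ∀ j k r e t → (j + k) * r + (e + t) ≡ j * r + (e + (k * r + t))
      rearrange = ℕ-Solver.solve-∀

    -- By uniqueness the k steps show in both coordinates: x = x′ + k α and y = y′ + k β, with x < m
    -- and y < l.
    box-gap : ∀ n e m l → m ≤ q → l ≤ p → ∀ j k →
      0 < box n e m l (j * r) → 0 < box n e m l ((j + k) * r) → k * α < m × k * β < l
    box-gap n e m l m≤q l≤p j k 0<j 0<j+k
      with box-positive n e m l (j * r) 0<j | box-positive n e m l ((j + k) * r) 0<j+k
    ... | (x , y , x<m , y<l , eq) | (x′ , y′ , _ , _ , eq′) =
      let (X≡x , Y≡y) = combination-unique p⊥q (x′ + k * α) (y′ + k * β) x y
                          (sym (+-cancelˡ-≡ e _ _ (chain-step n j k e e (x * p + y * q) x′ y′ eq eq′)))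
                          (<-≤-trans x<m m≤q) (<-≤-trans y<l l≤p)
      in ≤-<-trans (≤-trans (m≤n+m _ x′) (≤-reflexive X≡x)) x<m ,
         ≤-<-trans (≤-trans (m≤n+m _ y′) (≤-reflexive Y≡y)) y<l

    box≤1 : ∀ n e m l → m ≤ q → l ≤ p → ∀ i → box n e m l i ≤ 1
    box≤1 n e m l m≤q l≤p i =
      -- With window length 1 there cannot be two positions with a positive term; this is used
      -- within each row and then for the rows.
      ∑-spread m 1 row (λ x → ∑-spread l 1 (cell x) (λ y → indicator≤1 n _) (cell-gap x)) row-gap
      where
      cell : ℕ → ℕ → ℕ
      cell x y = indicator n (i + (e + (x * p + y * q)))

      row : ℕ → ℕ
      row x = ∑ l (cell x)

      same : ∀ x y x′ y′ → 0 < cell x y → 0 < cell x′ y′ → x * p + y * q ≡ x′ * p + y′ * q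
      same x y x′ y′ 0<₁ 0<₂ = +-cancelˡ-≡ e _ _ (+-cancelˡ-≡ i _ _
        (trans (sym (indicator-positive n _ 0<₁)) (indicator-positive n _ 0<₂)))

      zero-step : ∀ x k → x + k ≡ x → k < 1
      zero-step x k eq = s≤s (≤-reflexive (+-cancelˡ-≡ x k 0 (trans eq (sym (+-identityʳ x)))))

      cell-gap : ∀ x y k → y + k < l → 0 < cell x y → 0 < cell x (y + k) → k < 1
      cell-gap x y k y+k<l 0<₁ 0<₂ = zero-step y k (*-cancelʳ-≡ (y + k) y q
        (+-cancelˡ-≡ (x * p) _ _ (same x (y + k) x y 0<₂ 0<₁)))

      row-gap : ∀ x k → x + k < m → 0 < row x → 0 < row (x + k) → k < 1
      row-gap x k x+k<m 0<₁ 0<₂ with ∑-positive l (cell x) 0<₁ | ∑-positive l (cell (x + k)) 0<₂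
      ... | (y , _ , 0<cell) | (y′ , y′<l , 0<cell′) = zero-step x k (sym (proj₁
        (combination-unique p⊥q x y (x + k) y′ (same x y (x + k) y′ 0<cell 0<cell′)
          (<-≤-trans x+k<m m≤q) (<-≤-trans y′<l l≤p))))

    -- The representation at j has coordinates ((A - j) α, (A - j) β): the run descends to the
    -- corner (0, 0), which it reaches at j = A.
    box-attained : ∀ e m l A → (∀ k → k ≤ A → k * α < m × k * β < l) →
      ∀ j → j ≤ A → 0 < box (e + A * r) e m l (j * r)
    box-attained e m l A small j j≤A with m≤n⇒∃[o]m+o≡n j≤A
    ... | (k , refl) = let (kα<m , kβ<l) = small k (m≤n+m k j) in
      box-member _ e m l (j * r) (k * α) (k * β) kα<m kβ<l (begin
        e + (j + k) * r                           ≡⟨ rearrange e j k r ⟩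
        j * r + (e + (k * r + (0 * p + 0 * q)))   ≡⟨ cong (λ t → j * r + (e + t)) (step k 0 0) ⟩
        j * r + (e + (k * α * p + k * β * q))     ∎)
      where
      open ≡-Reasoning
      rearrange : ∀ e j k r → e + (j + k) * r ≡ j * r + (e + (k * r + 0))
      rearrange = ℕ-Solver.solve-∀

    module Boxes (a b c d : ℕ) (a+c≡q : a + c ≡ q) (b+d≡p : b + d ≡ p)
                 (bezout : a * p + b * q ≡ p * q + 1) where

      -- These count the representations that make the coefficient of Φ_pq at n − j r
      -- equal to +1 and −1, without truncated subtraction when j r > n.
      plus minus : ℕ → ℕ → ℕ
      plus  n j = box n 0 a b (j * r)
      minus n j = box n 1 c d (j * r)

      a≤q : a ≤ q
      a≤q = subst (a ≤_) a+c≡q (m≤m+n a c)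
      b≤p : b ≤ p
      b≤p = subst (b ≤_) b+d≡p (m≤m+n b d)
      c≤q : c ≤ q
      c≤q = subst (c ≤_) a+c≡q (m≤n+m c a)
      d≤p : d ≤ p
      d≤p = subst (d ≤_) b+d≡p (m≤n+m d b)

      -- Adding p q = a p + b q - 1 turns the relation into X p + Y q = x p + (y + p) q with X ≥ a >
      -- x. Then X is at least x + q, which forces Y ≤ y, whereas Y ≥ b > y.
      exclusion-≤ : ∀ n j k → 0 < plus n j → 0 < minus n (j + k) → ⊥
      exclusion-≤ n j k 0<plus 0<minus
        with box-positive n 0 a b (j * r) 0<plus | box-positive n 1 c d ((j + k) * r) 0<minus
      ... | (x , y , x<a , y<b , eq) | (x′ , y′ , _ , _ , eq′) =
        let X = x′ + a + k * α
            Y = y′ + b + k * β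
            XY≡ = begin-equality
              X * p + Y * q ≡⟨ left x′ y′ a b (k * α) (k * β) p q ⟩
              (x′ + k * α) * p + (y′ + k * β) * q + (a * p + b * q)
                ≡⟨ cong (λ t → (x′ + k * α) * p + (y′ + k * β) * q + t) bezout ⟩
              (x′ + k * α) * p + (y′ + k * β) * q + (p * q + 1)
                ≡⟨ middle ((x′ + k * α) * p + (y′ + k * β) * q) (p * q) ⟩
              1 + ((x′ + k * α) * p + (y′ + k * β) * q) + p * q
                ≡⟨ cong (_+ p * q) (chain-step n j k 0 1 (x * p + y * q) x′ y′ eq eq′) ⟨
              x * p + y * q + p * q ≡⟨ right x y p q ⟩
              x * p + (y + p) * q ∎
            a≤X = ≤-trans (m≤n+m a x′) (m≤m+n (x′ + a) _)
            b≤Y = ≤-trans (m≤n+m b y′) (m≤m+n (y′ + b) _)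
            x+q≤X = combination-jump p⊥q X Y x (y + p) XY≡ (<-≤-trans x<a a≤X)
        in <⇒≱ (<-≤-trans y<b b≤Y) (*-cancelʳ-≤ Y y q (+-cancelˡ-≤ ((x + q) * p) _ _ (begin
             (x + q) * p + Y * q ≤⟨ +-monoˡ-≤ (Y * q) (*-monoˡ-≤ p x+q≤X) ⟩
             X * p + Y * q       ≡⟨ XY≡ ⟩
             x * p + (y + p) * q ≡⟨ shift x y p q ⟩
             (x + q) * p + y * q ∎)))
        where
        open ≤-Reasoning
        left : ∀ x y a b u v p q →
          (x + a + u) * p + (y + b + v) * q ≡ (x + u) * p + (y + v) * q + (a * p + b * q)
        left = ℕ-Solver.solve-∀
        middle : ∀ s t → s + (t + 1) ≡ 1 + s + t
        middle = ℕ-Solver.solve-∀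
        right : ∀ x y p q → x * p + y * q + p * q ≡ x * p + (y + p) * q
        right = ℕ-Solver.solve-∀
        shift : ∀ x y p q → x * p + (y + p) * q ≡ (x + q) * p + y * q
        shift = ℕ-Solver.solve-∀

      -- After the same addition of p q, the negative term has coordinates x′ + a < q and y′ + b <
      -- p. Uniqueness then gives y′ + b = y + k β + p ≥ p.
      exclusion-≥ : ∀ n j k → 0 < minus n j → 0 < plus n (j + k) → ⊥
      exclusion-≥ n j k 0<minus 0<plus
        with box-positive n 0 a b ((j + k) * r) 0<plus | box-positive n 1 c d (j * r) 0<minus
      ... | (x , y , _ , _ , eq) | (x′ , y′ , x′<c , y′<d , eq′) =
        let Y≡ = proj₂ (combination-unique p⊥q (x + k * α) (y + k * β + p) (x′ + a) (y′ + b) (begin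
              (x + k * α) * p + (y + k * β + p) * q ≡⟨ left (x + k * α) (y + k * β) p q ⟩
              (x + k * α) * p + (y + k * β) * q + p * q
                ≡⟨ cong (_+ p * q) (chain-step n j k 1 0 (x′ * p + y′ * q) x y eq′ eq) ⟨
              1 + (x′ * p + y′ * q) + p * q   ≡⟨ middle (x′ * p + y′ * q) (p * q) ⟩
              x′ * p + y′ * q + (p * q + 1)   ≡⟨ cong (λ t → x′ * p + y′ * q + t) bezout ⟨
              x′ * p + y′ * q + (a * p + b * q) ≡⟨ right x′ y′ a b p q ⟩
              (x′ + a) * p + (y′ + b) * q ∎)
              (subst (x′ + a <_) (trans (+-comm c a) a+c≡q) (+-monoˡ-< a x′<c))
              (y′+b<p y′<d))
        in <⇒≱ (y′+b<p y′<d) (≤-trans (m≤n+m p _) (≤-reflexive Y≡))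
        where
        open ≡-Reasoning
        y′+b<p : ∀ {y′} → y′ < d → y′ + b < p
        y′+b<p y′<d = subst (_ <_) (trans (+-comm d b) b+d≡p) (+-monoˡ-< b y′<d)
        left : ∀ x y p q → x * p + (y + p) * q ≡ x * p + y * q + p * q
        left = ℕ-Solver.solve-∀
        middle : ∀ s t → 1 + s + t ≡ s + (t + 1)
        middle = ℕ-Solver.solve-∀
        right : ∀ x y a b p q → x * p + y * q + (a * p + b * q) ≡ (x + a) * p + (y + b) * q
        right = ℕ-Solver.solve-∀

      exclusion : ∀ n i j → 0 < plus n i → 0 < minus n j → ⊥
      exclusion n i j 0<plus 0<minus with ≤-total i j
      ... | inj₁ i≤j with m≤n⇒∃[o]m+o≡n i≤j
      ...   | (k , refl) = exclusion-≤ n i k 0<plus 0<minus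
      exclusion n i j 0<plus 0<minus | inj₂ j≤i with m≤n⇒∃[o]m+o≡n j≤i
      ...   | (k , refl) = exclusion-≥ n j k 0<minus 0<plus

      minus≡0 : ∀ n i → 0 < plus n i → ∀ j → minus n j ≡ 0
      minus≡0 n i 0<plus j = n≤0⇒n≡0 (≮⇒≥ (exclusion n i j 0<plus))

      plus≡0 : ∀ n j → 0 < minus n j → ∀ i → plus n i ≡ 0
      plus≡0 n j 0<minus i = n≤0⇒n≡0 (≮⇒≥ λ 0<plus → exclusion n i j 0<plus 0<minus)

      module Ceilings {A₁ A₂ B₁ B₂ : ℕ} (ceil₁ : IsCeiling a α A₁) (ceil₂ : IsCeiling b β A₂)
                      (ceil₃ : IsCeiling c α B₁) (ceil₄ : IsCeiling d β B₂) where
        A B : ℕ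
        A = A₁ ⊓ A₂
        B = B₁ ⊓ B₂

        plus-gap : ∀ n j k → 0 < plus n j → 0 < plus n (j + k) → k < A
        plus-gap n j k 0<j 0<j+k = let (kα<a , kβ<b) = box-gap n 0 a b a≤q b≤p j k 0<j 0<j+k in
          ⊓-pres-m< (proj₁ ceil₁ k kα<a) (proj₁ ceil₂ k kβ<b)

        minus-gap : ∀ n j k → 0 < minus n j → 0 < minus n (j + k) → k < B
        minus-gap n j k 0<j 0<j+k = let (kα<c , kβ<d) = box-gap n 1 c d c≤q d≤p j k 0<j 0<j+k in
          ⊓-pres-m< (proj₁ ceil₃ k kα<c) (proj₁ ceil₄ k kβ<d)

        both : ℕ → ℕ → ℕ
        both n j = plus n j + minus n j

        both-cases : ∀ n j → 0 < both n j → 0 < plus n j ⊎ 0 < minus n j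
        both-cases n j 0<both with plus n j
        ... | zero  = inj₂ 0<both
        ... | suc _ = inj₁ z<s

        both≤1 : ∀ n j → both n j ≤ 1
        both≤1 n j with plus n j in eq
        ... | zero  = box≤1 n 1 c d c≤q d≤p (j * r)
        ... | suc u = begin
          suc u + minus n j ≡⟨ cong (λ t → suc u + t) (minus≡0 n j (subst (0 <_) (sym eq) z<s) j) ⟩
          suc u + 0         ≡⟨ +-identityʳ (suc u) ⟩
          suc u             ≡⟨ eq ⟨
          plus n j          ≤⟨ box≤1 n 0 a b a≤q b≤p (j * r) ⟩
          1                 ∎
          where open ≤-Reasoning

        -- Two terms of opposite sign never meet, so every gap is governed by one box. The window
        -- `M` is arbitrary, so that both blocks of exponents can be taken in at once.
        ∑-both≤ : ∀ n M → ∑ M (both n) ≤ A ⊔ B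
        ∑-both≤ n M = ∑-spread M (A ⊔ B) (both n) (both≤1 n) λ i k _ 0<i 0<i+k →
          gap i k (both-cases n i 0<i) (both-cases n (i + k) 0<i+k)
          where
          gap : ∀ i k → 0 < plus n i ⊎ 0 < minus n i → 0 < plus n (i + k) ⊎ 0 < minus n (i + k) → k < A ⊔ B
          gap i k (inj₁ u)  (inj₁ u′) = m<n⇒m<n⊔o B (plus-gap n i k u u′)
          gap i k (inj₁ u)  (inj₂ v)  = contradiction v (exclusion n i (i + k) u)
          gap i k (inj₂ v)  (inj₁ u)  = contradiction v (exclusion n (i + k) i u)
          gap i k (inj₂ v)  (inj₂ v′) = m<n⇒m<o⊔n A (minus-gap n i k v v′)

open RepresentationCounts
open import Data.Nat.Base using (_<_; _≤_; _+_; _*_)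
open import Data.Integer.Base using (_-_; _⊓_; _⊔_)
open ≡ using (refl; sym; trans; cong; cong₂; subst)

-- Heights, ceilings and the relation between the two inverses.

coeff≤height : ∀ f n → ∣ ℤ[x].coeff f n ∣ ≤ height f
coeff≤height []      n       = z≤n
coeff≤height (a ∷ f) zero    = ℕ.m≤m⊔n _ _
coeff≤height (a ∷ f) (suc n) = ℕ.≤-trans (coeff≤height f n) (ℕ.m≤n⊔m _ _)

height≤ : ∀ f {h} → (∀ n → ∣ ℤ[x].coeff f n ∣ ≤ h) → height f ≤ h
height≤ []      bound = z≤n
height≤ (a ∷ f) bound = ℕ.⊔-lub (bound 0) (height≤ f (bound ∘ suc))

-- `ceiling` is computed as -⌊-m/n⌋. With ρ the remainder of -m one gets m + ρ = A n and 0 ≤ ρ < n,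
-- which yields both halves.
ceiling-isCeiling : ∀ m n .{{_ : NonZero n}} → ∃[ A ] ceiling (+ m / n) ≡ + A × IsCeiling m n A
ceiling-isCeiling m n@(suc _) = go (ℤ.- z) refl
  where
  z : ℤ
  z = (ℤ.- + m) ℤ./ + n
  ρ : ℕ
  ρ = (ℤ.- + m) ℤ.% + n

  spec : + (m + ρ) ≡ (ℤ.- z) ℤ.* + n
  spec = begin
    + m ℤ.+ + ρ                                 ≡⟨ cong (ℤ._+ + ρ) (ℤ.neg-involutive (+ m)) ⟨
    ℤ.- (ℤ.- + m) ℤ.+ + ρ                       ≡⟨ cong (λ i → ℤ.- i ℤ.+ + ρ) (ℤ.a≡a%n+[a/n]*n (ℤ.- + m) (+ n)) ⟩
    ℤ.- (+ ρ ℤ.+ z ℤ.* + n) ℤ.+ + ρ             ≡⟨ rearrange (+ ρ) z (+ n) ⟩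
    (ℤ.- z) ℤ.* + n                             ∎
    where
    open ≡-Reasoning
    rearrange : ∀ x y z → ℤ.- (x ℤ.+ y ℤ.* z) ℤ.+ x ≡ (ℤ.- y) ℤ.* z
    rearrange = ℤ-Solver.solve-∀

  go : ∀ c → ℤ.- z ≡ c → ∃[ A ] c ≡ + A × IsCeiling m n A
  go -[1+ _ ] eq = contradiction (trans spec (cong (ℤ._* + n) eq)) λ ()
  go (+ A)    eq = A , refl , above , below
    where
    m+ρ≡An : m + ρ ≡ A * n
    m+ρ≡An = ℤ.+-injective (trans spec (trans (cong (ℤ._* + n) eq) (sym (ℤ.pos-* A n))))

    above : ∀ k → k * n < m → k < A
    above k kn<m = ℕ.*-cancelʳ-< n k A (ℕ.<-≤-trans kn<m (subst (m ≤_) m+ρ≡An (ℕ.m≤m+n m ρ)))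

    below : ∀ k → k < A → k * n < m
    below k k<A = ℕ.+-cancelˡ-< n _ _ (begin-strict
      suc k * n ≤⟨ ℕ.*-monoˡ-≤ n k<A ⟩
      A * n     ≡⟨ m+ρ≡An ⟨
      m + ρ     <⟨ ℕ.+-monoʳ-< m (ℤ.n%d<d (ℤ.- + m) (+ n)) ⟩
      m + n     ≡⟨ ℕ.+-comm m n ⟩
      n + m     ∎)
      where open ℕ.≤-Reasoning

pos-cancel : ∀ m n → + (m + n) - + m ≡ + n
pos-cancel m n = begin
  + (m + n) - + m ≡⟨ ℤ.m-n≡m⊖n (m + n) m ⟩
  (m + n) ℤ.⊖ m   ≡⟨ ℤ.⊖-≥ (ℕ.m≤m+n m n) ⟩
  + (m + n ℕ.∸ m) ≡⟨ cong +_ (ℕ.m+n∸m≡n m n) ⟩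
  + n             ∎
  where open ≡-Reasoning

-- The number p a + q b - 1 is divisible by p and by q, hence by p q. It lies strictly between 0 and
-- 2 p q, so it equals p q.
inverses-bezout : ∀ {p q a b} .{{_ : NonZero p}} .{{_ : NonZero q}} → Coprime p q →
  IsInverseMod q p a → IsInverseMod p q b → a * p + b * q ≡ p * q + 1
inverses-bezout {p} {q} {a} {b} p⊥q a-inv b-inv = go (p * a) (q * b) refl refl 0<pa 0<qb
  (IsInverseMod.inverse a-inv) (IsInverseMod.inverse b-inv)
  where
  0<pa : 0 < p * a
  0<pa = ℕ.*-mono-< (ℕ.>-nonZero⁻¹ p) (IsInverseMod.positive a-inv)
  0<qb : 0 < q * b
  0<qb = ℕ.*-mono-< (ℕ.>-nonZero⁻¹ q) (IsInverseMod.positive b-inv)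
  pa<pq : p * a < p * q
  pa<pq = ℕ.*-monoʳ-< p (IsInverseMod.bounded a-inv)
  qb<pq : q * b < p * q
  qb<pq = subst (q * b <_) (ℕ.*-comm q p) (ℕ.*-monoʳ-< q (IsInverseMod.bounded b-inv))

  -- With the products abstracted to `u` and `v`, matching on successors lets the absolute values
  -- reduce to the predecessors.
  go : ∀ u v → p * a ≡ u → q * b ≡ v → 0 < u → 0 < v → q ∣ ∣ + u ℤ.- + 1 ∣ → p ∣ ∣ + v ℤ.- + 1 ∣ →
    a * p + b * q ≡ p * q + 1
  go (suc s) (suc t) pa≡ qb≡ _ _ q∣s p∣t = begin
    a * p + b * q         ≡⟨ cong₂ _+_ (trans (ℕ.*-comm a p) pa≡) (trans (ℕ.*-comm b q) qb≡) ⟩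
    suc s + suc t         ≡⟨ ℕ.+-comm 1 (s + suc t) ⟩
    s + suc t + 1         ≡⟨ cong (_+ 1) (once pq∣sum) ⟩
    p * q + 1             ∎
    where
    open ≡-Reasoning
    pq∣sum : p * q ∣ s + suc t
    pq∣sum = coprime-∣* p⊥q
      (subst (p ∣_) (sym (ℕ.+-suc s t)) (ℕ.∣m∣n⇒∣m+n (subst (p ∣_) pa≡ (ℕ.m∣m*n a)) p∣t))
      (ℕ.∣m∣n⇒∣m+n q∣s (subst (q ∣_) qb≡ (ℕ.m∣m*n b)))

    sum<2pq : s + suc t < 2 * (p * q)
    sum<2pq = ℕ.<-≤-trans (ℕ.+-mono-< (ℕ.<-trans (ℕ.n<1+n s) (subst (_< p * q) pa≡ pa<pq))
                                      (subst (_< p * q) qb≡ qb<pq))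
                          (ℕ.≤-reflexive (cong (λ x → p * q + x) (sym (ℕ.+-identityʳ (p * q)))))

    once : p * q ∣ s + suc t → s + suc t ≡ p * q
    once (divides zero          eq) = contradiction (trans (sym (ℕ.+-suc s t)) eq) λ ()
    once (divides (suc zero)    eq) = trans eq (ℕ.+-identityʳ (p * q))
    once (divides (suc (suc k)) eq) = contradiction sum<2pq
      (ℕ.≤⇒≯ (ℕ.≤-trans (ℕ.*-monoˡ-≤ (p * q) (s≤s (s≤s (z≤n {k})))) (ℕ.≤-reflexive (sym eq))))

-- The height of the explicit Ψ_pqr.

module InverseHeight
  (p q r α β : ℕ) .{{_ : NonZero p}} .{{_ : NonZero q}} .{{_ : NonZero α}} .{{_ : NonZero β}}
  (p⊥q : Coprime p q) (p<q : p < q) (r≡ : r ≡ α * p + β * q)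
  (a b c d : ℕ)
  (a+c≡q : a + c ≡ q) (b+d≡p : b + d ≡ p) (bezout : a * p + b * q ≡ p * q + 1)
  {A₁ A₂ B₁ B₂ : ℕ} (ceil₁ : IsCeiling a α A₁) (ceil₂ : IsCeiling b β A₂)
  (ceil₃ : IsCeiling c α B₁) (ceil₄ : IsCeiling d β B₂) where

  open LamLeung p q a b c d a+c≡q b+d≡p bezout using (Φpq; Ψpqr; ⟨⟩-Ψpqr; ⟨⟩-Φpq)
  open Chains p q r α β p⊥q r≡
  open Boxes a b c d a+c≡q b+d≡p bezout
  open Ceilings ceil₁ ceil₂ ceil₃ ceil₄
  open Range ℕ.+-0-commutativeMonoid using () renaming (fold< to ∑; fold<-ε to ∑-zero; fold<-+ to ∑-+; fold<-∙ to ∑-distrib)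
  open Range ℤ.+-0-commutativeMonoid using () renaming (fold< to ∑ℤ; fold<-cong to ∑ℤ-cong)

  δ≡indicator : ∀ n k → ℤ[x].δ n k ≡ + indicator n k
  δ≡indicator zero    zero    = refl
  δ≡indicator zero    (suc k) = refl
  δ≡indicator (suc n) zero    = refl
  δ≡indicator (suc n) (suc k) = δ≡indicator n k

  ∑ℤ-pos : ∀ n f → ∑ℤ n (λ i → + f i) ≡ + ∑ n f
  ∑ℤ-pos zero    f = refl
  ∑ℤ-pos (suc n) f = cong (λ s → + f 0 ℤ.+ s) (∑ℤ-pos n (f ∘ suc))

  ∑ℤ-difference : ∀ n f g → ∑ℤ n (λ i → + f i - + g i) ≡ + ∑ n f - + ∑ n g
  ∑ℤ-difference zero    f g = refl
  ∑ℤ-difference (suc n) f g = trans (cong (λ s → (+ f 0 - + g 0) ℤ.+ s) (∑ℤ-difference n (f ∘ suc) (g ∘ suc)))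
    (interchange (+ f 0) (+ g 0) (+ ∑ n (f ∘ suc)) (+ ∑ n (g ∘ suc)))
    where
    interchange : ∀ w x y z → (w - x) ℤ.+ (y - z) ≡ (w ℤ.+ y) - (x ℤ.+ z)
    interchange = ℤ-Solver.solve-∀

  coeff-Φpq : ∀ n j → ℤ[x].⟨ Φpq , (λ i → ℤ[x].δ n (j * r + i)) ⟩ ≡ + plus n j - + minus n j
  coeff-Φpq n j = trans (⟨⟩-Φpq (λ i → ℤ[x].δ n (j * r + i)))
    (cong₂ _-_ (count a b λ s → s) (count c d suc))
    where
    count : ∀ m l (e : ℕ → ℕ) →
      ∑ℤ m (λ x → ∑ℤ l (λ y → ℤ[x].δ n (j * r + e (x * p + y * q)))) ≡
      + ∑ m (λ x → ∑ l (λ y → indicator n (j * r + e (x * p + y * q))))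
    count m l e = trans (∑ℤ-cong m λ x → trans (∑ℤ-cong l λ y → δ≡indicator n _) (∑ℤ-pos l _)) (∑ℤ-pos m _)

  -- The low block is j < p, the high block q ≤ j < q + p.
  plusˡ plusʰ minusˡ minusʰ : ℕ → ℕ
  plusˡ  n = ∑ p (plus n)
  plusʰ  n = ∑ p (plus n ∘ (q ℕ.+_))
  minusˡ n = ∑ p (minus n)
  minusʰ n = ∑ p (minus n ∘ (q ℕ.+_))

  coeff-Ψpqr : ∀ n → ℤ[x].coeff (Ψpqr r) n ≡ (+ plusʰ n - + minusʰ n) - (+ plusˡ n - + minusˡ n)
  coeff-Ψpqr n = begin
    ℤ[x].coeff (Ψpqr r) n          ≡⟨ ℤ[x].coeff≈⟨⟩ (Ψpqr r) n ⟩
    ℤ[x].⟨ Ψpqr r , ℤ[x].δ n ⟩     ≡⟨ ⟨⟩-Ψpqr r (ℤ[x].δ n) ⟩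
    _ ≡⟨ cong₂ _-_ (trans (∑ℤ-cong p λ j → coeff-Φpq n (q + j)) (∑ℤ-difference p _ _))
                   (trans (∑ℤ-cong p (coeff-Φpq n)) (∑ℤ-difference p _ _)) ⟩
    (+ plusʰ n - + minusʰ n) - (+ plusˡ n - + minusˡ n) ∎
    where open ≡-Reasoning

  coeff-Ψpqr≤ : ∀ n → ∣ ℤ[x].coeff (Ψpqr r) n ∣ ≤ A ℕ.⊔ B
  coeff-Ψpqr≤ n = begin
    ∣ ℤ[x].coeff (Ψpqr r) n ∣ ≡⟨ cong ∣_∣ (coeff-Ψpqr n) ⟩
    ∣ (+ plusʰ n - + minusʰ n) - (+ plusˡ n - + minusˡ n) ∣
      ≤⟨ ℤ.∣i-j∣≤∣i∣+∣j∣ (+ plusʰ n - + minusʰ n) (+ plusˡ n - + minusˡ n) ⟩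
    ∣ + plusʰ n - + minusʰ n ∣ + ∣ + plusˡ n - + minusˡ n ∣
      ≤⟨ ℕ.+-mono-≤ (ℤ.∣i-j∣≤∣i∣+∣j∣ (+ plusʰ n) (+ minusʰ n)) (ℤ.∣i-j∣≤∣i∣+∣j∣ (+ plusˡ n) (+ minusˡ n)) ⟩
    (plusʰ n + minusʰ n) + (plusˡ n + minusˡ n)
      ≡⟨ cong₂ _+_ (∑-distrib p _ _) (∑-distrib p (plus n) (minus n)) ⟨
    ∑ p (both n ∘ (q ℕ.+_)) + ∑ p (both n)
      -- Enlarging the low block from p to q terms makes the two blocks adjacent, so that they form
      -- a single window.
      ≤⟨ ℕ.+-monoʳ-≤ _ (∑-mono (ℕ.<⇒≤ p<q) (both n)) ⟩
    ∑ p (both n ∘ (q ℕ.+_)) + ∑ q (both n)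
      ≡⟨ trans (ℕ.+-comm _ (∑ q (both n))) (sym (∑-+ q p (both n))) ⟩
    ∑ (q + p) (both n) ≤⟨ ∑-both≤ n (q + p) ⟩
    A ℕ.⊔ B ∎
    where
    open ℕ.≤-Reasoning
    ∑-mono : ∀ {m n} → m ≤ n → ∀ f → ∑ m f ≤ ∑ n f
    ∑-mono {m} m≤n f with ℕ.m≤n⇒∃[o]m+o≡n m≤n
    ... | (o , refl) = ℕ.≤-trans (ℕ.m≤m+n _ _) (ℕ.≤-reflexive (sym (∑-+ m o f)))

  -- A run that starts at j = 0 in a box with l ≤ p rows ends before j = p < q,
  -- so only the lower block of exponents j r contributes.
  run-attained : ∀ e m l {K₁ K₂} → l ≤ p → IsCeiling m α K₁ → IsCeiling l β K₂ →
    let run = λ n j → box n e m l (j * r) in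
    (∀ n j k → 0 < run n j → 0 < run n (j + k) → k < K₁ ℕ.⊓ K₂) →
    (∀ n → 0 < run n 0 → (∀ j → run n (q + j) ≡ 0) → ∣ ℤ[x].coeff (Ψpqr r) n ∣ ≡ ∑ p (run n)) →
    K₁ ℕ.⊓ K₂ ≤ height (Ψpqr r)
  run-attained e m l {K₁} {K₂} l≤p ceil ceil′ gap value = go (K₁ ℕ.⊓ K₂) refl
    where
    go : ∀ K → K ≡ K₁ ℕ.⊓ K₂ → K ≤ height (Ψpqr r)
    go zero    _  = z≤n
    go (suc K) eq = begin
      suc K                     ≤⟨ ∑-≥ K<p (λ j j<1+K → positive j (ℕ.s≤s⁻¹ j<1+K)) ⟩
      ∑ p (run n)               ≡⟨ value n (positive 0 z≤n) high ⟨
      ∣ ℤ[x].coeff (Ψpqr r) n ∣ ≤⟨ coeff≤height (Ψpqr r) n ⟩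
      height (Ψpqr r)           ∎
      where
      open ℕ.≤-Reasoning
      -- K steps make a run of K + 1 terms, at j = 0, ..., K.
      n : ℕ
      n = e + K * r

      run : ℕ → ℕ → ℕ
      run n j = box n e m l (j * r)

      small : ∀ k → k ≤ K → k * α < m × k * β < l
      small k k≤K = let k<⊓ = subst (k <_) eq (s≤s k≤K) in
        proj₂ ceil k (ℕ.m<n⊓o⇒m<n K₁ K₂ k<⊓) , proj₂ ceil′ k (ℕ.m<n⊓o⇒m<o K₁ K₂ k<⊓)

      positive : ∀ j → j ≤ K → 0 < run n j
      positive = box-attained e m l K small

      K<p : K < p
      K<p = ℕ.<-≤-trans (ℕ.≤-<-trans (ℕ.m≤m*n K β) (proj₂ (small K ℕ.≤-refl))) l≤p

      high : ∀ j → run n (q + j) ≡ 0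
      high j = ℕ.n≤0⇒n≡0 (ℕ.≮⇒≥ λ 0<high →
        ℕ.<⇒≱ (gap n 0 (q + j) (positive 0 z≤n) 0<high)
          (subst (_≤ q + j) eq (ℕ.≤-trans K<p (ℕ.≤-trans (ℕ.<⇒≤ p<q) (ℕ.m≤m+n q j)))))

  ∑-≡0 : ∀ {f} → (∀ j → f j ≡ 0) → ∑ p f ≡ 0
  ∑-≡0 f≡0 = ∑-zero p λ j _ → f≡0 j

  -- A positive term at j = 0 rules out all negative ones, and the high block is empty, so the
  -- coefficient is -`plusˡ n`. For `B≤height` it is `minusˡ n` in the same way.
  A≤height : A ≤ height (Ψpqr r)
  A≤height = run-attained 0 a b b≤p ceil₁ ceil₂ plus-gap λ n 0<plus high → begin
    ∣ ℤ[x].coeff (Ψpqr r) n ∣   ≡⟨ cong ∣_∣ (coeff-Ψpqr n) ⟩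
    ∣ (+ plusʰ n - + minusʰ n) - (+ plusˡ n - + minusˡ n) ∣
      ≡⟨ cong₂ (λ i j → ∣ i - j ∣)
           (cong₂ (λ i j → + i - + j) (∑-≡0 high) (∑-≡0 (minus≡0 n 0 0<plus ∘ (q ℕ.+_))))
           (cong (λ i → + plusˡ n - + i) (∑-≡0 (minus≡0 n 0 0<plus))) ⟩
    ∣ + 0 - (+ plusˡ n - + 0) ∣ ≡⟨ cong ∣_∣ (ℤ.+-identityˡ (ℤ.- (+ plusˡ n - + 0))) ⟩
    ∣ ℤ.- (+ plusˡ n - + 0) ∣   ≡⟨ ℤ.∣-i∣≡∣i∣ (+ plusˡ n - + 0) ⟩
    plusˡ n + 0                 ≡⟨ ℕ.+-identityʳ (plusˡ n) ⟩
    plusˡ n                     ∎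
    where open ≡-Reasoning

  B≤height : B ≤ height (Ψpqr r)
  B≤height = run-attained 1 c d d≤p ceil₃ ceil₄ minus-gap λ n 0<minus high → begin
    ∣ ℤ[x].coeff (Ψpqr r) n ∣    ≡⟨ cong ∣_∣ (coeff-Ψpqr n) ⟩
    ∣ (+ plusʰ n - + minusʰ n) - (+ plusˡ n - + minusˡ n) ∣
      ≡⟨ cong₂ (λ i j → ∣ i - j ∣)
           (cong₂ (λ i j → + i - + j) (∑-≡0 (plus≡0 n 0 0<minus ∘ (q ℕ.+_))) (∑-≡0 high))
           (cong (λ i → + i - + minusˡ n) (∑-≡0 (plus≡0 n 0 0<minus))) ⟩
    ∣ + 0 - (+ 0 - + minusˡ n) ∣ ≡⟨ cong ∣_∣ (ℤ.+-identityˡ (ℤ.- (+ 0 - + minusˡ n))) ⟩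
    ∣ ℤ.- (+ 0 - + minusˡ n) ∣   ≡⟨ ℤ.∣-i∣≡∣i∣ (+ 0 - + minusˡ n) ⟩
    ∣ + 0 - + minusˡ n ∣         ≡⟨ cong ∣_∣ (ℤ.+-identityˡ (ℤ.- (+ minusˡ n))) ⟩
    ∣ ℤ.- (+ minusˡ n) ∣         ≡⟨ ℤ.∣-i∣≡∣i∣ (+ minusˡ n) ⟩
    minusˡ n                     ∎
    where open ≡-Reasoning

  -- Lists that agree up to trailing zeros are different arguments of `height`, so both inequalities
  -- pass through the coefficients.
  height-≋ : ∀ Ψ → Ψ ℤ[x].≋ Ψpqr r → height Ψ ≡ A ℕ.⊔ B
  height-≋ Ψ Ψ≋ = ℕ.≤-antisym
    (height≤ Ψ λ n → subst (_≤ A ℕ.⊔ B) (cong ∣_∣ (sym (Ψ≋ n))) (coeff-Ψpqr≤ n))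
    (ℕ.≤-trans (ℕ.⊔-lub A≤height B≤height)
      (height≤ (Ψpqr r) λ n → subst (_≤ height Ψ) (cong ∣_∣ (Ψ≋ n)) (coeff≤height Ψ n)))

theorem1 : ∀ {c ℓ₁ ℓ₂} (K : HeytingField c ℓ₁ ℓ₂) → let open Cyclotomic K in
    CharacteristicZero →
    ∀ (p q r : ℕ) → OddPrime p → OddPrime q → OddPrime r → p < q → q < r →
    ∀ (α β : ℕ) .{{_ : NonZero α}} .{{_ : NonZero β}} →
    r ≡ α * p + β * q → r ≤ φ (p * q) →
    ∀ (p′ q′ : ℕ) → IsInverseMod q p p′ → IsInverseMod p q q′ →
    ∀ (ζ : HeytingField.Carrier K) → IsPrimitiveRoot (p * q * r) ζ →
    InverseCyclotomicHeight (p * q * r) ζ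
    ((ceiling (+ p′ / α) ⊓ ceiling (+ q′ / β))
    ⊔ (ceiling ((+ q - + p′) / α) ⊓ ceiling ((+ p - + q′) / β)))
theorem1 K char0 p q r (p-prime , _) (q-prime , _) (r-prime , _) p<q q<r α β r≡ _ p′ q′ p′-inv q′-inv ζ ζ-prim
  -- The differences c = q - p′ and d = p - q′ enter as additive complements, without truncated
  -- subtraction.
  with ℕ.m≤n⇒∃[o]m+o≡n (ℕ.<⇒≤ (IsInverseMod.bounded p′-inv)) | ℕ.m≤n⇒∃[o]m+o≡n (ℕ.<⇒≤ (IsInverseMod.bounded q′-inv))
... | (c , p′+c≡q) | (d , q′+d≡p) =
  (Ψpqr r , inverse) , λ Ψ Ψ-inverse → begin
    + height Ψ ≡⟨ cong +_ (height-≋ Ψ (inverseCyclotomic-unique char0 (p * q * r) ζ Ψ (Ψpqr r) Ψ-inverse inverse)) ⟩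
    (+ A₁ ⊓ + A₂) ⊔ (+ B₁ ⊓ + B₂)
      ≡⟨ cong₂ _⊔_ (cong₂ _⊓_ A₁≡ A₂≡) (cong₂ _⊓_ B₁≡ B₂≡) ⟨
    _ ∎
  where
  open ≡-Reasoning
  open InverseCyclotomic K
  instance
    p≢0 : NonZero p
    p≢0 = prime⇒nonZero p-prime
    q≢0 : NonZero q
    q≢0 = prime⇒nonZero q-prime
    r≢0 : NonZero r
    r≢0 = prime⇒nonZero r-prime
    pqr≢0 : NonZero (p * q * r)
    pqr≢0 = ℕ.m*n≢0 (p * q) r {{ℕ.m*n≢0 p q}}

  coprime : ∀ {m n} .{{_ : NonZero m}} → Prime n → m < n → Coprime m n
  coprime n-prime m<n = Coprimality.sym (prime⇒coprime n-prime m<n)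

  p⊥q : Coprime p q
  p⊥q = coprime q-prime p<q

  ceil₁ = ceiling-isCeiling p′ α
  ceil₂ = ceiling-isCeiling q′ β
  ceil₃ = ceiling-isCeiling c α
  ceil₄ = ceiling-isCeiling d β
  A₁ = proj₁ ceil₁
  A₂ = proj₁ ceil₂
  B₁ = proj₁ ceil₃
  B₂ = proj₁ ceil₄

  complement : ∀ m n k γ .{{_ : NonZero γ}} → m + n ≡ k → ceiling ((+ k - + m) / γ) ≡ ceiling (+ n / γ)
  complement m n _ γ refl = cong (λ i → ceiling (i / γ)) (pos-cancel m n)

  A₁≡ : ceiling (+ p′ / α) ≡ + A₁
  A₁≡ = proj₁ (proj₂ ceil₁)
  A₂≡ : ceiling (+ q′ / β) ≡ + A₂
  A₂≡ = proj₁ (proj₂ ceil₂)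
  B₁≡ : ceiling ((+ q - + p′) / α) ≡ + B₁
  B₁≡ = trans (complement p′ c q α p′+c≡q) (proj₁ (proj₂ ceil₃))
  B₂≡ : ceiling ((+ p - + q′) / β) ≡ + B₂
  B₂≡ = trans (complement q′ d p β q′+d≡p) (proj₁ (proj₂ ceil₄))

  bezout : p′ * p + q′ * q ≡ p * q + 1
  bezout = inverses-bezout p⊥q p′-inv q′-inv

  open LamLeung p q p′ q′ c d p′+c≡q q′+d≡p bezout using (Ψpqr; Ψpqr-spec)
  open InverseHeight p q r α β p⊥q p<q r≡ p′ q′ c d p′+c≡q q′+d≡p bezout
    (proj₂ (proj₂ ceil₁)) (proj₂ (proj₂ ceil₂)) (proj₂ (proj₂ ceil₃)) (proj₂ (proj₂ ceil₄)) using (height-≋)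

  inverse : Cyclotomic.IsInverseCyclotomic K (p * q * r) ζ (Ψpqr r)
  inverse = inverseCyclotomic-pqr p-prime q-prime r-prime p⊥q
    (coprime r-prime (ℕ.<-trans p<q q<r)) (coprime r-prime q<r) ζ-prim (Ψpqr r) (Ψpqr-spec r)
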